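{- Let $p$ be an odd prime, and let $k,m$ be positive integers with $km=p-1$. Let $G$ be the multiplicative group $\{r+p\mathbb{Z}: r=1,\ldots,p-1\}$ and $H$ its subgroup $\{x^m+p\mathbb{Z}: x=1,\ldots,p-1\}$ of order $k$. Suppose that the $m$ distinct cosets of $H$ in $G$ are $$\{a_{1j}+p\mathbb{Z}: j=1,\ldots,k\},\ \ldots,\ \{a_{mj}+p\mathbb{Z}: j=1,\ldots,k\}$$ with $1\le a_{i1}<\cdots<a_{ik}\le p-1$ for all $i=1,\ldots,m$. Then $$\prod_{i=1}^m\prod_{1\le s<t\le k}(a_{it}-a_{is})\equiv\begin{cases}(-1)^{\frac{p+1}2\cdot\frac{p-1}{2m}+\lfloor\frac{p-3}4\rfloor}\left(\frac{p-1}2\right)!\pmod p&\text{if } p\equiv1\pmod{2m},\\(-1)^{\frac{p+1}2\cdot\frac{p-1-m}{2m}}\pmod p&\text{if } p\equiv1+m\pmod{2m}.\end{cases}$$ -}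

module Defs where

open import Algebra.Bundles using (Group; AbelianGroup)
open import Data.Fin.Base using (Fin; inject; Fin′)
open import Data.Integer.Base using (ℤ; +_; -_; _+_; _-_; _*_; _^_; _%ℕ_; _/ℕ_; 1ℤ; 0ℤ; ∣_∣)
open import Data.Integer.DivMod using (n%ℕd<d; a≡a%ℕn+[a/ℕn]*n)
open import Data.Integer.Divisibility.Signed
open import Data.Integer.Properties
open import Data.Integer.Solver using (module +-*-Solver)
open import Data.Nat.Base as ℕ using (ℕ; suc; NonZero; _≤_; _∸_)
import Data.Nat.Coprimality as ℕ
import Data.Nat.Divisibility as ℕ
import Data.Nat.GCD as ℕ
import Data.Nat.Properties as ℕ
open import Data.Nat.Primality using (Prime; euclidsLemma; prime⇒nonZero; prime⇒nonTrivial)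
open import Data.Product.Base using (∃; _×_; _,_)
open import Data.Sum.Base using (inj₁; inj₂)
open import Level using (Level; _⊔_) renaming (suc to lsuc)
open import Relation.Binary.PropositionalEquality
  using (_≡_; refl; sym; trans; cong; subst)
open import Relation.Nullary.Negation using (¬_)
open import Relation.Unary using (Pred; _≐_)

import Algebra.Properties.CommutativeMonoid.Sum *-1-commutativeMonoid as Product

open +-*-Solver

private
  variable
    c ℓ r : Level

infix 4 _≡_[mod_]

_≡_[mod_] : ℤ → ℤ → ℕ → Set
a ≡ b [mod n ] = + n ∣ a - b

-- The product over a finite index set: the library's big operator `sum`, in the
-- monoid (ℤ , * , 1).
∏ : ∀ {n} → (Fin n → ℤ) → ℤ
∏ = Product.sum

-- ∏_{1 ≤ s < t ≤ k} (a_t - a_s); for each t, `Fin′ t` is the set of indices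
-- s < t, and `inject` embeds it in `Fin k`.
differenceProduct : ∀ {k} → (Fin k → ℕ) → ℤ
differenceProduct a = ∏ λ t → ∏ λ (s : Fin′ t) → + a t - + a (inject s)

module _ (G : Group c ℓ) where
  open Group G

  record Subgroup r : Set (c ⊔ ℓ ⊔ lsuc r) where
    field
      member    : Pred Carrier r
      resp      : ∀ {x y} → x ≈ y → member x → member y
      ε-closed  : member ε
      ∙-closed  : ∀ {x y} → member x → member y → member (x ∙ y)
      ⁻¹-closed : ∀ {x} → member x → member (x ⁻¹)

  module _ (H : Subgroup r) where
    open Subgroup H

    coset : Carrier → Pred Carrier (c ⊔ ℓ ⊔ r)
    coset g x = ∃ λ h → member h × x ≈ g ∙ h

    -- A 0, …, A (m - 1) are the cosets of H, each listed exactly once.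
    record AreTheDistinctCosets {m s} (A : Fin m → Pred Carrier s)
      : Set (c ⊔ ℓ ⊔ r ⊔ s) where
      field
        isCoset  : ∀ i → ∃ λ g → A i ≐ coset g
        distinct : ∀ {i j} → A i ≐ A j → i ≡ j
        complete : ∀ g → ∃ λ i → coset g ≐ A i

-- `residue r _ _` stands for the class r + pℤ.
record Residue (p : ℕ) : Set where
  constructor residue
  field
    rep     : ℕ
    1≤rep   : 1 ≤ rep
    rep≤p-1 : rep ≤ p ∸ 1

open Residue public

-- {a_j + pℤ : j = 1, …, k}
residueSet : ∀ {p k} → (Fin k → ℕ) → Pred (Residue p) _
residueSet {p} a x = ∃ λ j → + rep x ≡ + a j [mod p ]

mod-refl : ∀ n a → a ≡ a [mod n ]
mod-refl n a = subst (+ n ∣_) (sym (i≡j⇒i-j≡0 {a} refl)) (divides 0ℤ refl)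

mod-sym : ∀ n a b → a ≡ b [mod n ] → b ≡ a [mod n ]
mod-sym n a b e = subst (+ n ∣_)
  (solve 2 (λ a b → :- (a :- b) := b :- a) refl a b) (∣m⇒∣-m e)

mod-trans : ∀ n a b d → a ≡ b [mod n ] → b ≡ d [mod n ] → a ≡ d [mod n ]
mod-trans n a b d e f = subst (+ n ∣_)
  (solve 3 (λ a b d → (a :- b) :+ (b :- d) := a :- d) refl a b d)
  (∣m∣n⇒∣m+n e f)

mod-* : ∀ n a b d e → a ≡ b [mod n ] → d ≡ e [mod n ] → a * d ≡ b * e [mod n ]
mod-* n a b d e f g = subst (+ n ∣_)
  (solve 4 (λ a b d e → (a :- b) :* d :+ b :* (d :- e) := a :* d :- b :* e)
    refl a b d e)
  (∣m∣n⇒∣m+n (∣m⇒∣m*n d f) (∣n⇒∣m*n b g))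

mod-^ : ∀ n a b k → a ≡ b [mod n ] → a ^ k ≡ b ^ k [mod n ]
mod-^ n a b ℕ.zero  e = mod-refl n 1ℤ
mod-^ n a b (suc k) e = mod-* n a b (a ^ k) (b ^ k) e (mod-^ n a b k e)

mod-∣ : ∀ n a b → a ≡ b [mod n ] → + n ∣ b → + n ∣ a
mod-∣ n a b e d = subst (+ n ∣_)
  (solve 2 (λ a b → (a :- b) :+ b := a) refl a b) (∣m∣n⇒∣m+n e d)

%-mod : ∀ p .{{_ : NonZero p}} x → + (x %ℕ p) ≡ x [mod p ]
%-mod p x = mod-sym p x (+ (x %ℕ p)) (divides (x /ℕ p) (trans
  (cong (_- + (x %ℕ p)) (a≡a%ℕn+[a/ℕn]*n x p))
  (solve 2 (λ u v → (u :+ v) :- u := v) refl (+ (x %ℕ p)) (x /ℕ p * + p))))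

module _ (p : ℕ) (prime : Prime p) where
  private
    instance
      p≢0 : NonZero p
      p≢0 = prime⇒nonZero prime

  p∤1 : ¬ (+ p ∣ 1ℤ)
  p∤1 d = ℕ.<⇒≱ (ℕ.nonTrivial⇒n>1 p {{prime⇒nonTrivial prime}})
                  (ℕ.∣⇒≤ (∣⇒∣ᵤ d))

  p∤* : ∀ x y → ¬ (+ p ∣ x) → ¬ (+ p ∣ y) → ¬ (+ p ∣ x * y)
  p∤* x y p∤x p∤y d
    with euclidsLemma ∣ x ∣ ∣ y ∣ prime (subst (p ℕ.∣_) (abs-* x y) (∣⇒∣ᵤ d))
  ... | inj₁ e = p∤x (∣ᵤ⇒∣ e)
  ... | inj₂ e = p∤y (∣ᵤ⇒∣ e)

  rep<p : (x : Residue p) → rep x ℕ.< p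
  rep<p x = ℕ.≤-<-trans (rep≤p-1 x) (ℕ.≤-reflexive (ℕ.suc-pred p))

  p∤rep : (x : Residue p) → ¬ (+ p ∣ + rep x)
  p∤rep x d = ℕ.<⇒≱ (rep<p x) (ℕ.∣⇒≤ {{ℕ.>-nonZero (1≤rep x)}} (∣⇒∣ᵤ d))

  val : Residue p → ℤ
  val x = + rep x

  class : (x : ℤ) → ¬ (+ p ∣ x) → Residue p
  class x p∤x = residue (x %ℕ p) (ℕ.n≢0⇒n>0 x%p≢0)
                        (ℕ.<⇒≤pred (n%ℕd<d x p))
    where
    x%p≢0 : ¬ (x %ℕ p ≡ 0)
    x%p≢0 e = p∤x (mod-∣ p x (+ (x %ℕ p))
      (mod-sym p (+ (x %ℕ p)) x (%-mod p x))
      (subst (λ u → + p ∣ + u) (sym e) (divides 0ℤ refl)))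

  bézout : (x : Residue p) → ∃ λ y → y * val x ≡ 1ℤ [mod p ]
  bézout x with ℕ.coprime-Bézout
    (ℕ.prime⇒coprime prime {{ℕ.>-nonZero (1≤rep x)}} (rep<p x))
  ... | ℕ.Bézout.+- u v eq = - + v , divides (- + u) (step
        (trans (cong (_+_ 1ℤ) (sym (pos-* v (rep x))))
          (trans (cong +_ eq) (pos-* u p))))
    where
    step : + 1 + + v * val x ≡ + u * + p → - + v * val x - 1ℤ ≡ - + u * + p
    step e = trans
      (solve 2 (λ v x → :- v :* x :- con 1ℤ := :- (con 1ℤ :+ v :* x)) refl (+ v) (val x))
      (trans (cong -_ e) (neg-distribˡ-* (+ u) (+ p)))
  ... | ℕ.Bézout.-+ u v eq = + v , divides (+ u) (step
        (trans (cong (_+_ 1ℤ) (sym (pos-* u p)))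
          (trans (cong +_ eq) (pos-* v (rep x)))))
    where
    step : + 1 + + u * + p ≡ + v * val x → + v * val x - 1ℤ ≡ + u * + p
    step e = trans (cong (_- 1ℤ) (sym e))
      (solve 2 (λ u p → (con 1ℤ :+ u :* p) :- con 1ℤ := u :* p) refl (+ u) (+ p))

  infixl 7 _·_
  _·_ : Residue p → Residue p → Residue p
  x · y = class (val x * val y) (p∤* (val x) (val y) (p∤rep x) (p∤rep y))

  one : Residue p
  one = class 1ℤ p∤1

  inv : Residue p → Residue p
  inv x with y , e ← bézout x = class y λ d →
    p∤1 (mod-∣ p 1ℤ (y * val x) (mod-sym p (y * val x) 1ℤ e) (∣m⇒∣m*n (val x) d))

  infix 4 _≈_
  _≈_ : Residue p → Residue p → Set
  x ≈ y = val x ≡ val y [mod p ]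

  ·-val : ∀ x y → val (x · y) ≡ val x * val y [mod p ]
  ·-val x y = %-mod p (val x * val y)

  via : ∀ {a b} u v → a ≡ u [mod p ] → u ≡ v → b ≡ v [mod p ] → a ≡ b [mod p ]
  via {a} {b} u .u e refl f = mod-trans p a u b e (mod-sym p b u f)

  inverse-unique : ∀ a x b y → a * x ≡ 1ℤ [mod p ] → b * y ≡ 1ℤ [mod p ] →
                   x ≡ y [mod p ] → a ≡ b [mod p ]
  inverse-unique a x b y ax≡1 by≡1 x≡y = via {a} {b} (a * (b * x)) (b * (a * x))
    (mod-sym p (a * (b * x)) a
      (subst (λ u → a * (b * x) ≡ u [mod p ]) (*-identityʳ a)
        (mod-* p a a (b * x) 1ℤ (mod-refl p a)
          (mod-trans p (b * x) (b * y) 1ℤ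
            (mod-* p b b x y (mod-refl p b) x≡y) by≡1))))
    (solve 3 (λ a b x → a :* (b :* x) := b :* (a :* x)) refl a b x)
    (mod-sym p (b * (a * x)) b
      (subst (λ u → b * (a * x) ≡ u [mod p ]) (*-identityʳ b)
        (mod-* p b b (a * x) 1ℤ (mod-refl p b) ax≡1)))

  ·-cong : ∀ {x y u v} → x ≈ y → u ≈ v → x · u ≈ y · v
  ·-cong {x} {y} {u} {v} e f =
    mod-trans p (val (x · u)) (val x * val u) (val (y · v)) (·-val x u)
      (mod-trans p (val x * val u) (val y * val v) (val (y · v))
        (mod-* p (val x) (val y) (val u) (val v) e f)
        (mod-sym p (val (y · v)) (val y * val v) (·-val y v)))

  ·-assoc : ∀ x y z → (x · y) · z ≈ x · (y · z)
  ·-assoc x y z = via {val ((x · y) · z)} {val (x · (y · z))}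
    (val x * val y * val z) (val x * (val y * val z))
    (mod-trans p (val ((x · y) · z)) (val (x · y) * val z) (val x * val y * val z)
      (·-val (x · y) z)
      (mod-* p (val (x · y)) (val x * val y) (val z) (val z)
        (·-val x y) (mod-refl p (val z))))
    (*-assoc (val x) (val y) (val z))
    (mod-trans p (val (x · (y · z))) (val x * val (y · z)) (val x * (val y * val z))
      (·-val x (y · z))
      (mod-* p (val x) (val x) (val (y · z)) (val y * val z)
        (mod-refl p (val x)) (·-val y z)))

  ·-comm : ∀ x y → x · y ≈ y · x
  ·-comm x y = via {val (x · y)} {val (y · x)} (val x * val y) (val y * val x)
    (·-val x y) (*-comm (val x) (val y)) (·-val y x)

  ≈-trans : ∀ {x y z} → x ≈ y → y ≈ z → x ≈ z
  ≈-trans {x} {y} {z} = mod-trans p (val x) (val y) (val z)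

  ·-identityˡ : ∀ x → one · x ≈ x
  ·-identityˡ x = mod-trans p (val (one · x)) (val one * val x) (val x) (·-val one x)
    (subst (λ u → val one * val x ≡ u [mod p ]) (*-identityˡ (val x))
      (mod-* p (val one) 1ℤ (val x) (val x) (%-mod p 1ℤ) (mod-refl p (val x))))

  inv-val : ∀ x → val (inv x) * val x ≡ 1ℤ [mod p ]
  inv-val x with y , e ← bézout x =
    mod-trans p (+ (y %ℕ p) * val x) (y * val x) 1ℤ
      (mod-* p (+ (y %ℕ p)) y (val x) (val x) (%-mod p y) (mod-refl p (val x))) e

  ·-inverseˡ : ∀ x → inv x · x ≈ one
  ·-inverseˡ x = mod-trans p (val (inv x · x)) (val (inv x) * val x) (val one)
    (·-val (inv x) x)
    (mod-trans p (val (inv x) * val x) 1ℤ (val one) (inv-val x)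
      (mod-sym p (val one) 1ℤ (%-mod p 1ℤ)))

  inv-cong : ∀ {x y} → x ≈ y → inv x ≈ inv y
  inv-cong {x} {y} e =
    inverse-unique (val (inv x)) (val x) (val (inv y)) (val y) (inv-val x) (inv-val y) e

  unitGroup : AbelianGroup _ _
  unitGroup = record
    { Carrier = Residue p
    ; _≈_     = _≈_
    ; _∙_     = _·_
    ; ε       = one
    ; _⁻¹     = inv
    ; isAbelianGroup = record
      { isGroup = record
        { isMonoid = record
          { isSemigroup = record
            { isMagma = record
              { isEquivalence = record
                { refl  = λ {x} → mod-refl p (val x)
                ; sym   = λ {x} {y} → mod-sym p (val x) (val y)
                ; trans = λ {x} {y} {z} → ≈-trans {x} {y} {z}
                }
              ; ∙-cong = λ {x} {y} {u} {v} → ·-cong {x} {y} {u} {v}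
              }
            ; assoc = ·-assoc
            }
          ; identity = ·-identityˡ , λ x →
              ≈-trans {x · one} {one · x} {x} (·-comm x one) (·-identityˡ x)
          }
        ; inverse = ·-inverseˡ , λ x →
            ≈-trans {x · inv x} {inv x · x} {one} (·-comm x (inv x)) (·-inverseˡ x)
        ; ⁻¹-cong = λ {x} {y} → inv-cong {x} {y}
        }
      ; comm = ·-comm
      }
    }

  ^-* : ∀ a b m → a ^ m * b ^ m ≡ (a * b) ^ m
  ^-* a b ℕ.zero  = refl
  ^-* a b (suc m) = trans
    (solve 4 (λ a b c d → (a :* c) :* (b :* d) := (a :* b) :* (c :* d)) refl
      a b (a ^ m) (b ^ m))
    (cong (a * b *_) (^-* a b m))

  1^ : ∀ m → 1ℤ ^ m ≡ 1ℤ
  1^ ℕ.zero  = refl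
  1^ (suc m) = trans (*-identityˡ (1ℤ ^ m)) (1^ m)

  -- {x^m + pℤ : x = 1, …, p - 1}
  powerSubgroup : ℕ → Subgroup (AbelianGroup.group unitGroup) _
  powerSubgroup m = record
    { member = λ y → ∃ λ x → 1 ≤ x × x ≤ p ∸ 1 × + rep y ≡ (+ x) ^ m [mod p ]
    ; resp = λ { {y} {z} y≈z (x , 1≤x , x≤p-1 , e) → x , 1≤x , x≤p-1 ,
        mod-trans p (val z) (val y) ((+ x) ^ m) (mod-sym p (val y) (val z) y≈z) e }
    ; ε-closed = rep one , 1≤rep one , rep≤p-1 one ,
        mod-trans p (val one) 1ℤ (val one ^ m) (%-mod p 1ℤ)
          (mod-sym p (val one ^ m) 1ℤ
            (subst (λ u → val one ^ m ≡ u [mod p ]) (1^ m)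
              (mod-^ p (val one) 1ℤ m (%-mod p 1ℤ))))
    ; ∙-closed = λ
        { {y} {z} (x , 1≤x , x≤p-1 , e) (w , 1≤w , w≤p-1 , f) →
          let X = residue x 1≤x x≤p-1
              W = residue w 1≤w w≤p-1
          in rep (X · W) , 1≤rep (X · W) , rep≤p-1 (X · W) ,
             via {val (y · z)} {val (X · W) ^ m} ((+ x) ^ m * (+ w) ^ m) ((+ x * + w) ^ m)
               (mod-trans p (val (y · z)) (val y * val z) ((+ x) ^ m * (+ w) ^ m)
                 (·-val y z)
                 (mod-* p (val y) ((+ x) ^ m) (val z) ((+ w) ^ m) e f))
               (^-* (+ x) (+ w) m)
               (mod-^ p (val (X · W)) (+ x * + w) m (·-val X W)) }
    ; ⁻¹-closed = λ
        { {y} (x , 1≤x , x≤p-1 , e) →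
          let X = residue x 1≤x x≤p-1
              b = val (inv X)
          in rep (inv X) , 1≤rep (inv X) , rep≤p-1 (inv X) ,
             inverse-unique (val (inv y)) (val y) (b ^ m) ((+ x) ^ m) (inv-val y)
               (subst (λ u → u ≡ 1ℤ [mod p ]) (sym (^-* b (+ x) m))
                 (subst (λ u → (b * + x) ^ m ≡ u [mod p ]) (1^ m)
                   (mod-^ p (b * + x) 1ℤ m (inv-val X))))
               e }
    }

{-# OPTIONS --safe #-}

-- Write p = 2n + 1 and call two nonzero residues related when they lie in the same
-- coset of H, so that the product runs over all related pairs x < y. Ordering each pair
-- instead so that d = y − x mod p lies in {1, …, n} replaces the factor by ±d, with sign
-- −1 exactly for the pairs with |y − x| > n. Multiplication by d identifies the related
-- pairs of difference d with those of difference 1, and double counting shows that there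
-- are k − 1 of these. Hence the product is ± (n!)^(k−1), and (n!)² ≡ (−1)^(n+1) by
-- Wilson's theorem. The sign is the parity of the number of related pairs with
-- |y − x| > n: the involution (x , y) ↦ (p − y , p − x) leaves only the pairs with
-- x + y = p, which are related if and only if −1 ∈ H. Finally −1 ∈ H if and only if k is
-- even: z ↦ −1 − z acts on the k − 1 solutions z of "z and z + 1 are related" with n as
-- its only possible fixed point, and (n , n + 1) = (n , −n).

module Submission where

open import Defs using (_≡_[mod_]; ∏; differenceProduct; AreTheDistinctCosets; residueSet; unitGroup; powerSubgroup)
open import Defs using (mod-refl; mod-sym; mod-trans; mod-*; %-mod; p∤1; Residue; residue; rep; class; bézout; ·-val; Subgroup)
open import Algebra.Bundles using (CommutativeMonoid; Group; AbelianGroup)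
open import Data.Bool.Base using (if_then_else_)
open import Data.Empty using (⊥)
open import Data.Fin.Base as Fin using (Fin; zero; suc; toℕ; punchIn; inject; Fin′)
import Data.Fin.Permutation as Perm
import Data.Fin.Properties as Fin
open import Data.Integer.Base as ℤ using (ℤ; +_; -_; _%ℕ_; 0ℤ; 1ℤ; -1ℤ; ∣_∣)
open import Data.Integer.DivMod using (n%ℕd<d)
open import Data.Integer.Divisibility.Signed using (∣⇒∣ᵤ; ∣ᵤ⇒∣; _∣?_; ∣m⇒∣-m; ∣m∣n⇒∣m+n) renaming (_∣_ to _∣ℤ_)
import Data.Integer.Properties as ℤ
open import Data.Integer.Solver using () renaming (module +-*-Solver to ℤ-Solver)
open import Data.Nat.Base as ℕ using (ℕ; zero; suc; z≤n; s≤s; NonZero; _+_; _*_; _∸_; _/_; _!; _≤_; _<_)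
open import Data.Nat.Divisibility using (_∣_; divides; m%n≡0⇒n∣m; *-cancelʳ-∣; >⇒∤; ∣-refl)
import Data.Nat.DivMod as ℕ
open import Data.Nat.Primality using (Prime; euclidsLemma; prime⇒nonZero; prime⇒nonTrivial)
import Data.Nat.Properties as ℕ
open import Data.Nat.Properties using (m*n≢0)
open import Data.Nat.Solver using () renaming (module +-*-Solver to ℕ-Solver)
open import Data.Product.Base using (∃; _×_; _,_; proj₁; proj₂)
open import Data.Sum.Base as Sum using (_⊎_; [_,_]′)
open import Function.Base using (_∘_; _$_)
open import Level using (Level; 0ℓ)
open import Relation.Binary.Definitions using (tri<; tri≈; tri>)
open import Relation.Binary.PropositionalEquality as ≡ using (_≡_; _≢_)
open import Relation.Nullary using (Dec; yes; no; does; ¬_; contradiction; _×-dec_; ¬?)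
open import Relation.Nullary.Decidable using (map′)
open import Relation.Unary using (Pred)

-- The two cases of the theorem are k even and k odd: as (n!)² is a sign, (n!)^(k-1) keeps one
-- factor n! exactly when k is even. A product over related pairs is taken over all pairs of
-- residues, with the factor 1 wherever a condition fails. It is then a product over a square
-- matrix, and each involution argument (inverses in Wilson's theorem, z ↦ -1 - z, the pairs at
-- distance more than n) is arranged so that the involution becomes transposition. One lemma,
-- `sum-antisym`, then removes everything off the diagonal, and the fixed points are read off the
-- diagonal. Counting pairs and multiplying their differences need the same rearrangements of double
-- sums, once in (ℕ, +) and once in (ℤ, *) modulo p; hence the general commutative monoid. Residues
-- are handled as integers up to congruence, which leaves all identities to the ring solver over ℤ.

between? : ∀ j i → Dec (1 ≤ i × i ≤ j)
between? j i = (1 ℕ.≤? i) ×-dec (i ℕ.≤? j)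

-- The body unfolds to the sum of `Count.when (P? i) 1`, so the multiplicity produced by
-- `sum-when-const` in any monoid is definitionally the number `neighbours` defined later.
count : ∀ n {p} {P : Fin n → Set p} → (∀ i → Dec (P i)) → ℕ
count n P? = Σ.sum {n} λ i → if does (P? i) then 1 else 0
  where import Algebra.Properties.CommutativeMonoid.Sum ℕ.+-0-commutativeMonoid as Σ

-- Big operators with conditional terms in a commutative monoid.

module BigOperator {c ℓ} (M : CommutativeMonoid c ℓ) where
  open CommutativeMonoid M
  open import Algebra.Properties.CommutativeMonoid.Sum M public
  open import Algebra.Properties.CommutativeSemigroup commutativeSemigroup using (interchange)
  open import Algebra.Properties.Monoid.Mult monoid public using () renaming (_×_ to infixr 8 _•_)
  open import Relation.Binary.Reasoning.Setoid setoid

  private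
    variable
      p q : Level
      P : Set p
      Q : Set q
      n : ℕ

  when : Dec P → Carrier → Carrier
  when P? x = if does P? then x else ε

  when-yes : (P? : Dec P) → ∀ {x} → P → when P? x ≈ x
  when-yes (yes _) _ = refl
  when-yes (no ¬p) p = contradiction p ¬p

  when-no : (P? : Dec P) → ∀ {x} → ¬ P → when P? x ≈ ε
  when-no (yes p) ¬p = contradiction p ¬p
  when-no (no _)  _  = refl

  when-cong : (P? : Dec P) (Q? : Dec Q) → (P → Q) → (Q → P) →
              ∀ {x y} → (P → x ≈ y) → when P? x ≈ when Q? y
  when-cong (yes p) Q? f g e = trans (e p) (sym (when-yes Q? (f p)))
  when-cong (no ¬p) Q? f g e = sym (when-no Q? (¬p ∘ g))

  when-congʳ : (P? : Dec P) → ∀ {x y} → (P → x ≈ y) → when P? x ≈ when P? y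
  when-congʳ P? = when-cong P? P? (λ p → p) (λ p → p)

  when-∙ : (P? : Dec P) → ∀ x y → when P? (x ∙ y) ≈ when P? x ∙ when P? y
  when-∙ (yes _) x y = refl
  when-∙ (no _)  x y = sym (identityˡ ε)

  when-ε : (P? : Dec P) → when P? ε ≈ ε
  when-ε (yes _) = refl
  when-ε (no _)  = refl

  sum-cong : ∀ n {f g : Fin n → Carrier} → (∀ i → f i ≈ g i) → sum f ≈ sum g
  sum-cong _ = sum-cong-≋

  sum-distrib : ∀ n (f g : Fin n → Carrier) → sum (λ i → f i ∙ g i) ≈ sum f ∙ sum g
  sum-distrib _ = ∑-distrib-+

  sum-ε : ∀ n {f : Fin n → Carrier} → (∀ i → f i ≈ ε) → sum f ≈ ε
  sum-ε n f≈ε = trans (sum-cong n f≈ε) (sum-replicate-zero n)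

  sum-single : ∀ {f : Fin n → Carrier} i → (∀ j → j ≢ i → f j ≈ ε) → sum f ≈ f i
  sum-single {suc n} {f} i f≈ε = begin
    sum f                       ≈⟨ sum-remove f ⟩
    f i ∙ sum (f ∘ punchIn i)   ≈⟨ ∙-congˡ (sum-ε n (λ j → f≈ε (punchIn i j) (Fin.punchInᵢ≢i i j))) ⟩
    f i ∙ ε                     ≈⟨ identityʳ (f i) ⟩
    f i                         ∎

  -- The entries at (i, j) and (j, i) cancel, so only the diagonal survives. The induction peels off
  -- the first row and the first column, which cancel entry by entry.
  sum-antisym : (f : Fin n → Fin n → Carrier) → (∀ i j → i ≢ j → f i j ∙ f j i ≈ ε) →
                sum (λ i → sum (f i)) ≈ sum (λ i → f i i)
  sum-antisym {zero}  f f≈ε = refl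
  sum-antisym {suc n} f f≈ε = begin
    (f₀₀ ∙ row) ∙ sum (λ i → f (suc i) zero ∙ sum (λ j → f (suc i) (suc j)))
      ≈⟨ ∙-congˡ (sum-distrib n _ _) ⟩
    (f₀₀ ∙ row) ∙ (col ∙ rest)
      ≈⟨ interchange _ _ _ _ ⟩
    (f₀₀ ∙ col) ∙ (row ∙ rest)
      ≈⟨ assoc _ _ _ ⟩
    f₀₀ ∙ (col ∙ (row ∙ rest))
      ≈⟨ ∙-congˡ (assoc _ _ _) ⟨
    f₀₀ ∙ ((col ∙ row) ∙ rest)
      ≈⟨ ∙-congˡ (∙-congʳ (trans (sym (sum-distrib n _ _)) (sum-ε n (λ i → f≈ε (suc i) zero λ ())))) ⟩
    f₀₀ ∙ (ε ∙ rest)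
      ≈⟨ ∙-congˡ (identityˡ rest) ⟩
    f₀₀ ∙ rest
      ≈⟨ ∙-congˡ (sum-antisym (λ i j → f (suc i) (suc j)) λ i j i≢j → f≈ε _ _ (i≢j ∘ Fin.suc-injective)) ⟩
    f₀₀ ∙ sum (λ i → f (suc i) (suc i)) ∎
    where
    f₀₀  = f zero zero
    row  = sum (λ j → f zero (suc j))
    col  = sum (λ i → f (suc i) zero)
    rest = sum (λ i → sum (λ j → f (suc i) (suc j)))

  -- Here `g` is the running total of `f` from 1 on. The induction is on the cutoff `j` with `n`
  -- fixed, because the applications all range over the p residues and differ in the cutoff (n, 2n
  -- and ⌊n/2⌋).
  sum-between : (f g : ℕ → Carrier) → g 0 ≈ ε → (∀ i → g (suc i) ≈ f (suc i) ∙ g i) →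
                ∀ j → j < n → sum {n} (λ i → when (between? j (toℕ i)) (f (toℕ i))) ≈ g j
  sum-between {n} f g g₀ gₛ zero j<n =
    trans (sum-ε n λ i → when-no (between? 0 (toℕ i)) λ (1≤i , i≤0) → ℕ.<⇒≱ 1≤i i≤0) (sym g₀)
  sum-between {n} f g g₀ gₛ (suc j) j<n = begin
    sum {n} (λ i → when (between? (suc j) (toℕ i)) (f (toℕ i)))
      ≈⟨ sum-cong n (λ i → split (toℕ i)) ⟩
    sum {n} (λ i → when (toℕ i ℕ.≟ suc j) (f (toℕ i)) ∙ when (between? j (toℕ i)) (f (toℕ i)))
      ≈⟨ sum-distrib n _ _ ⟩
    sum {n} (λ i → when (toℕ i ℕ.≟ suc j) (f (toℕ i))) ∙ sum {n} (λ i → when (between? j (toℕ i)) (f (toℕ i)))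
      ≈⟨ ∙-cong last (sum-between f g g₀ gₛ j (ℕ.<-trans (ℕ.n<1+n j) j<n)) ⟩
    f (suc j) ∙ g j
      ≈⟨ gₛ j ⟨
    g (suc j) ∎
    where
    split : ∀ i → when (between? (suc j) i) (f i) ≈ when (i ℕ.≟ suc j) (f i) ∙ when (between? j i) (f i)
    split i with i ℕ.≟ suc j
    ... | yes ≡.refl = trans (when-yes (between? (suc j) i) (s≤s z≤n , ℕ.≤-refl))
      (sym (trans (∙-cong (when-yes (i ℕ.≟ i) ≡.refl)
                           (when-no (between? j i) λ (_ , i≤j) → ℕ.1+n≰n i≤j))
                  (identityʳ _)))
    ... | no i≢1+j = trans
      (when-cong (between? (suc j) i) (between? j i)
        (λ (1≤i , i≤1+j) → 1≤i , ℕ.≤-pred (ℕ.≤∧≢⇒< i≤1+j i≢1+j))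
        (λ (1≤i , i≤j) → 1≤i , ℕ.m≤n⇒m≤1+n i≤j)
        (λ _ → refl))
      (sym (trans (∙-congʳ (when-no (i ℕ.≟ suc j) i≢1+j)) (identityˡ _)))

    last : sum {n} (λ i → when (toℕ i ℕ.≟ suc j) (f (toℕ i))) ≈ f (suc j)
    last = trans
      (sum-single (Fin.fromℕ< j<n) λ i i≢ → when-no (toℕ i ℕ.≟ suc j)
        λ e → i≢ (Fin.toℕ-injective (≡.trans e (≡.sym (Fin.toℕ-fromℕ< j<n)))))
      (trans (when-yes (toℕ (Fin.fromℕ< j<n) ℕ.≟ suc j) (Fin.toℕ-fromℕ< j<n))
        (reflexive (≡.cong f (Fin.toℕ-fromℕ< j<n))))

  -- Translates the inner product of `differenceProduct`, indexed by `Fin′ t`, into a conditional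
  -- product over the full index set, where it can be compared with products over residues.
  sum-inject : (t : Fin n) (f : Fin n → Carrier) →
               sum (λ (s : Fin′ t) → f (inject s)) ≈ sum (λ s → when (s Fin.<? t) (f s))
  sum-inject t@zero f = sym (sum-ε _ λ s → when-no (s Fin.<? t) {f s} λ ())
  sum-inject (suc t) f = ∙-cong refl $ trans (sum-inject t (f ∘ suc)) $
    sum-cong _ λ s → when-cong (s Fin.<? t) (suc s Fin.<? suc t) s≤s ℕ.≤-pred {f (suc s)} (λ _ → refl)

  sum-when-const : ∀ n {p} {P : Fin n → Set p} (P? : ∀ i → Dec (P i)) v →
                   sum (λ i → when (P? i) v) ≈ count n P? • v
  sum-when-const zero    P? v = refl
  sum-when-const (suc n) P? v = by-cases (P? zero) (sum-when-const n (P? ∘ suc) v)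
    where
    by-cases : ∀ {p} {P : Set p} (d : Dec P) {s m} → s ≈ m • v →
               when d v ∙ s ≈ ((if does d then 1 else 0) ℕ.+ m) • v
    by-cases (yes _) e = ∙-congˡ e
    by-cases (no _)  e = trans (identityˡ _) e

-- Unlike `_≡_[mod_]`, which unfolds to a divisibility, this record lets Agda
-- infer both sides of a congruence.
record Congruent (p : ℕ) (a b : ℤ) : Set where
  constructor [_]
  field difference : a ≡ b [mod p ]

open Congruent public

-- Congruences modulo p and sums over all residues.

module Modulo (p : ℕ) where

  open ℤ-Solver

  infix 4 _≅_ _≅?_

  _≅_ : ℤ → ℤ → Set
  _≅_ = Congruent p

  _≅?_ : ∀ a b → Dec (a ≅ b)
  a ≅? b = map′ [_] difference (+ p ∣? a ℤ.- b)

  ≅-refl : ∀ {a} → a ≅ a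
  ≅-refl {a} = [ mod-refl p a ]

  ≅-reflexive : ∀ {a b} → a ≡ b → a ≅ b
  ≅-reflexive ≡.refl = ≅-refl

  ≅-sym : ∀ {a b} → a ≅ b → b ≅ a
  ≅-sym {a} {b} [ e ] = [ mod-sym p a b e ]

  ≅-trans : ∀ {a b c} → a ≅ b → b ≅ c → a ≅ c
  ≅-trans {a} {b} {c} [ e ] [ f ] = [ mod-trans p a b c e f ]

  *-cong : ∀ {a b c d} → a ≅ b → c ≅ d → a ℤ.* c ≅ b ℤ.* d
  *-cong {a} {b} {c} {d} [ e ] [ f ] = [ mod-* p a b c d e f ]

  +-cong : ∀ {a b c d} → a ≅ b → c ≅ d → a ℤ.+ c ≅ b ℤ.+ d
  +-cong {a} {b} {c} {d} [ e ] [ f ] = [ ≡.subst (+ p ∣ℤ_)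
    (solve 4 (λ a b c d → (a :- b) :+ (c :- d) := (a :+ c) :- (b :+ d)) ≡.refl a b c d)
    (∣m∣n⇒∣m+n e f) ]

  neg-cong : ∀ {a b} → a ≅ b → - a ≅ - b
  neg-cong {a} {b} [ e ] = [ ≡.subst (+ p ∣ℤ_)
    (solve 2 (λ a b → :- (a :- b) := (:- a) :- (:- b)) ≡.refl a b) (∣m⇒∣-m e) ]

  ∣⇒≅0 : ∀ {a} → + p ∣ℤ a → a ≅ 0ℤ
  ∣⇒≅0 {a} d = [ ≡.subst (+ p ∣ℤ_) (≡.sym (ℤ.+-identityʳ a)) d ]

  ≅0⇒∣ : ∀ {a} → a ≅ 0ℤ → + p ∣ℤ a
  ≅0⇒∣ {a} [ d ] = ≡.subst (+ p ∣ℤ_) (ℤ.+-identityʳ a) d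

  *-commutativeMonoid : CommutativeMonoid 0ℓ 0ℓ
  *-commutativeMonoid = record
    { Carrier = ℤ ; _≈_ = _≅_ ; _∙_ = ℤ._*_ ; ε = 1ℤ
    ; isCommutativeMonoid = record
      { isMonoid = record
        { isSemigroup = record
          { isMagma = record
            { isEquivalence = record { refl = ≅-refl ; sym = ≅-sym ; trans = ≅-trans }
            ; ∙-cong = *-cong }
          ; assoc = λ a b c → ≅-reflexive (ℤ.*-assoc a b c) }
        ; identity = ≅-reflexive ∘ ℤ.*-identityˡ , ≅-reflexive ∘ ℤ.*-identityʳ }
      ; comm = λ a b → ≅-reflexive (ℤ.*-comm a b) } }

  p≅0 : + p ≅ 0ℤ
  p≅0 = ∣⇒≅0 (∣ᵤ⇒∣ ∣-refl)

  small-≅⇒≡ : ∀ {a b} → a ℕ.< p → b ℕ.< p → + a ≅ + b → a ≡ b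
  small-≅⇒≡ {a} {b} a<p b<p [ d ] = ℤ.+-injective $ ℤ.i-j≡0⇒i≡j (+ a) (+ b) $ ℤ.∣i∣≡0⇒i≡0 $ zero-of (∣⇒∣ᵤ d) bound
    where
    bound : ∣ + a ℤ.- + b ∣ ℕ.< p
    bound = ℕ.≤-<-trans
      (≡.subst (λ i → ∣ i ∣ ℕ.≤ a ℕ.⊔ b) (≡.sym (ℤ.m-n≡m⊖n a b)) (ℤ.∣m⊝n∣≤m⊔n a b))
      (ℕ.⊔-pres-<m a<p b<p)

    zero-of : ∀ {i} → p ∣ i → i ℕ.< p → i ≡ 0
    zero-of {zero}  _ _   = ≡.refl
    zero-of {suc i} d i<p = contradiction d (>⇒∤ i<p)

  module _ .{{_ : NonZero p}} where

    %-≅ : ∀ a → + (a %ℕ p) ≅ a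
    %-≅ a = [ %-mod p a ]

    %-unique : ∀ {a r} → r ℕ.< p → a ≅ + r → a %ℕ p ≡ r
    %-unique {a} r<p a≅r = small-≅⇒≡ (n%ℕd<d a p) r<p (≅-trans (%-≅ a) a≅r)

    %-cong : ∀ {a b} → a ≅ b → a %ℕ p ≡ b %ℕ p
    %-cong {a} {b} a≅b = %-unique (n%ℕd<d b p) (≅-trans a≅b (≅-sym (%-≅ b)))

    reduce : ℤ → Fin p
    reduce a = Fin.fromℕ< (n%ℕd<d a p)

    lift : Fin p → ℤ
    lift i = + toℕ i

    lift-reduce : ∀ a → lift (reduce a) ≅ a
    lift-reduce a = ≅-trans (≅-reflexive (≡.cong +_ (Fin.toℕ-fromℕ< (n%ℕd<d a p)))) (%-≅ a)

    lift-injective : ∀ {i j} → lift i ≅ lift j → i ≡ j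
    lift-injective {i} {j} e = Fin.toℕ-injective (small-≅⇒≡ (Fin.toℕ<n i) (Fin.toℕ<n j) e)

    lift-% : ∀ i → lift i %ℕ p ≡ toℕ i
    lift-% i = %-unique (Fin.toℕ<n i) ≅-refl

    reduce-unique : ∀ {a i} → a ≅ lift i → reduce a ≡ i
    reduce-unique {a} e = lift-injective (≅-trans (lift-reduce a) e)

    module _ {c ℓ} (M : CommutativeMonoid c ℓ) where
      open CommutativeMonoid M
      open BigOperator M

      -- The summand is a function on ℤ and not on `Fin p`, so that shifts, scalings and negations
      -- are plain integer arithmetic; reduction modulo p is confined to `reindex`, whose maps are
      -- inverse to each other only up to congruence.
      residueSum : (ℤ → Carrier) → Carrier
      residueSum f = sum {p} (λ i → f (lift i))

      residueSum-cong : ∀ {f g} → (∀ a → f a ≈ g a) → residueSum f ≈ residueSum g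
      residueSum-cong f≈g = sum-cong p (f≈g ∘ lift)

      residueSum-single : (f : ℤ → Carrier) → (∀ {a b} → a ≅ b → f a ≈ f b) → ∀ c →
                          (∀ a → ¬ a ≅ c → f a ≈ ε) → residueSum f ≈ f c
      residueSum-single f f-cong c f≈ε = trans
        (sum-single (reduce c) λ i i≢ → f≈ε (lift i) (i≢ ∘ ≡.sym ∘ reduce-unique ∘ ≅-sym))
        (f-cong (lift-reduce c))

      reindex : (f : ℤ → Carrier) → (∀ {a b} → a ≅ b → f a ≈ f b) →
                (φ ψ : ℤ → ℤ) →
                (∀ {a b} → a ≅ b → φ a ≅ φ b) → (∀ {a b} → a ≅ b → ψ a ≅ ψ b) →
                (∀ a → φ (ψ a) ≅ a) → (∀ a → ψ (φ a) ≅ a) →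
                residueSum f ≈ residueSum (f ∘ φ)
      reindex f f-cong φ ψ φ-cong ψ-cong φψ ψφ = trans
        (sum-permute (f ∘ lift) (Perm.permutation (reduce ∘ φ ∘ lift) (reduce ∘ ψ ∘ lift)
          (λ i → reduce-unique (≅-trans (φ-cong (lift-reduce (ψ (lift i)))) (φψ (lift i))))
          (λ i → reduce-unique (≅-trans (ψ-cong (lift-reduce (φ (lift i)))) (ψφ (lift i))))))
        (sum-cong p λ i → f-cong (lift-reduce (φ (lift i))))

      reindex-shift : (f : ℤ → Carrier) → (∀ {a b} → a ≅ b → f a ≈ f b) → ∀ d →
                      residueSum f ≈ residueSum (λ a → f (a ℤ.+ d))
      reindex-shift f f-cong d = reindex f f-cong (ℤ._+ d) (ℤ._- d)
        (λ e → +-cong e ≅-refl) (λ e → +-cong e ≅-refl)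
        (λ a → ≅-reflexive (solve 2 (λ a d → (a :- d) :+ d := a) ≡.refl a d))
        (λ a → ≅-reflexive (solve 2 (λ a d → (a :+ d) :- d := a) ≡.refl a d))

      reindex-scale : (f : ℤ → Carrier) → (∀ {a b} → a ≅ b → f a ≈ f b) → ∀ u v → v ℤ.* u ≅ 1ℤ →
                      residueSum f ≈ residueSum (λ a → f (u ℤ.* a))
      reindex-scale f f-cong u v vu≅1 = reindex f f-cong (u ℤ.*_) (v ℤ.*_)
        (*-cong (≅-refl {u})) (*-cong (≅-refl {v}))
        (λ a → unit (solve 3 (λ u v a → u :* (v :* a) := (v :* u) :* a) ≡.refl u v a))
        (λ a → unit (solve 3 (λ u v a → v :* (u :* a) := (v :* u) :* a) ≡.refl u v a))
        where
        unit : ∀ {a b} → b ≡ (v ℤ.* u) ℤ.* a → b ≅ a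
        unit {a} e = ≅-trans (≅-reflexive e)
          (≅-trans (*-cong vu≅1 (≅-refl {a})) (≅-reflexive (ℤ.*-identityˡ a)))

      reindex-negate : (f : ℤ → Carrier) → (∀ {a b} → a ≅ b → f a ≈ f b) →
                       residueSum f ≈ residueSum (λ a → f (- a))
      reindex-negate f f-cong = reindex f f-cong -_ -_ neg-cong neg-cong
        (λ a → ≅-reflexive (ℤ.neg-involutive a)) (λ a → ≅-reflexive (ℤ.neg-involutive a))

[-1]^n*[-1]^n≡1 : ∀ n → -1ℤ ℤ.^ n ℤ.* -1ℤ ℤ.^ n ≡ 1ℤ
[-1]^n*[-1]^n≡1 zero    = ≡.refl
[-1]^n*[-1]^n≡1 (suc n) = ≡.trans
  (solve 1 (λ s → (con -1ℤ :* s) :* (con -1ℤ :* s) := s :* s) ≡.refl (-1ℤ ℤ.^ n))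
  ([-1]^n*[-1]^n≡1 n)
  where open ℤ-Solver

module Count = BigOperator ℕ.+-0-commutativeMonoid

-- Arithmetic modulo p = 2n + 1: the residues 1, ..., n and Wilson's theorem.

module OddPrime (p : ℕ) (p-prime : Prime p) (n : ℕ) (p≡ : p ≡ suc (n ℕ.+ n)) where

  open Modulo p public
  open ℤ-Solver

  instance
    p≢0 : NonZero p
    p≢0 = prime⇒nonZero p-prime

  open BigOperator *-commutativeMonoid public

  module ≅-Reasoning where
    open import Relation.Binary.Reasoning.Setoid (CommutativeMonoid.setoid *-commutativeMonoid) public

  n<p : n ℕ.< p
  n<p = ≡.subst (n ℕ.<_) (≡.sym p≡) (ℕ.s≤s (ℕ.m≤m+n n n))

  1≇0 : ¬ 1ℤ ≅ 0ℤ
  1≇0 e = p∤1 p p-prime (≅0⇒∣ e)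

  *-zero : ∀ {a b} → a ℤ.* b ≅ 0ℤ → a ≅ 0ℤ ⊎ b ≅ 0ℤ
  *-zero {a} {b} e = Sum.map (∣⇒≅0 ∘ ∣ᵤ⇒∣) (∣⇒≅0 ∘ ∣ᵤ⇒∣)
    (euclidsLemma ∣ a ∣ ∣ b ∣ p-prime (≡.subst (p ∣_) (ℤ.abs-* a b) (∣⇒∣ᵤ (≅0⇒∣ e))))

  inverse : ∀ a → ¬ a ≅ 0ℤ → ∃ λ b → b ℤ.* a ≅ 1ℤ
  inverse a a≇0 with bézout p p-prime (class p p-prime a (a≇0 ∘ ∣⇒≅0))
  ... | b , e = b , ≅-trans (*-cong (≅-refl {b}) (≅-sym (%-≅ a))) [ e ]

  inverse-unique : ∀ {a b c} → a ℤ.* b ≅ 1ℤ → a ℤ.* c ≅ 1ℤ → b ≅ c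
  inverse-unique {a} {b} {c} ab ac = begin
    b                ≡⟨ ℤ.*-identityʳ b ⟨
    b ℤ.* 1ℤ         ≈⟨ *-cong (≅-refl {b}) ac ⟨
    b ℤ.* (a ℤ.* c)  ≡⟨ solve 3 (λ a b c → b :* (a :* c) := (a :* b) :* c) ≡.refl a b c ⟩
    (a ℤ.* b) ℤ.* c  ≈⟨ *-cong ab (≅-refl {c}) ⟩
    1ℤ ℤ.* c         ≡⟨ ℤ.*-identityˡ c ⟩
    c                ∎
    where open ≅-Reasoning

  %≡0 : ∀ {a} → a ≅ 0ℤ → a %ℕ p ≡ 0
  %≡0 = %-unique (ℕ.≤-<-trans ℕ.z≤n n<p)

  1≤% : ∀ {a} → ¬ a ≅ 0ℤ → 1 ℕ.≤ a %ℕ p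
  1≤% {a} a≇0 = ℕ.n≢0⇒n>0 λ e → a≇0 (≅-trans (≅-sym (%-≅ a)) (≅-reflexive (≡.cong +_ e)))

  1≤n : 1 ℕ.≤ n
  1≤n = ℕ.n≢0⇒n>0 λ n≡0 → ℕ.<⇒≢ (ℕ.nonTrivial⇒n>1 p {{prime⇒nonTrivial p-prime}})
    (≡.sym (≡.trans p≡ (≡.cong (λ n → suc (n ℕ.+ n)) n≡0)))

  negate-% : ∀ a → ¬ a ≅ 0ℤ → (- a) %ℕ p ≡ p ℕ.∸ a %ℕ p
  negate-% a a≇0 = %-unique (ℕ.∸-monoʳ-< 1≤r r≤p) $ begin
    - a               ≈⟨ neg-cong (%-≅ a) ⟨
    - + r             ≡⟨ ℤ.+-identityˡ (- + r) ⟨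
    0ℤ ℤ.- + r        ≈⟨ +-cong p≅0 (≅-refl {(- + r)}) ⟨
    + p ℤ.- + r       ≡⟨ ℤ.m-n≡m⊖n p r ⟩
    p ℤ.⊖ r           ≡⟨ ℤ.⊖-≥ r≤p ⟩
    + (p ℕ.∸ r)       ∎
    where
    open ≅-Reasoning

    r = a %ℕ p
    r≤p : r ℕ.≤ p
    r≤p = ℕ.<⇒≤ (n%ℕd<d a p)
    1≤r : 1 ℕ.≤ r
    1≤r = 1≤% a≇0

  -- A half-system in the sense of Gauss's lemma: one residue from each pair ±a of nonzero residues.
  Half : ℤ → Set
  Half a = 1 ℕ.≤ a %ℕ p × a %ℕ p ℕ.≤ n

  half? : ∀ a → Dec (Half a)
  half? a = between? n (a %ℕ p)

  half-cong : ∀ {a b} → a ≅ b → Half a → Half b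
  half-cong a≅b = ≡.subst (λ r → 1 ℕ.≤ r × r ℕ.≤ n) (%-cong a≅b)

  half≇0 : ∀ {a} → Half a → ¬ a ≅ 0ℤ
  half≇0 (1≤r , _) a≅0 = ℕ.n>0⇒n≢0 1≤r (%≡0 a≅0)

  -- For nonzero `a` the residues of `a` and `- a` add up to p = 2n + 1, so they cannot both be at
  -- most n; in the next lemma, they cannot both exceed n.
  half-negate⇒¬half : ∀ {a} → Half (- a) → ¬ Half a
  half-negate⇒¬half {a} (_ , r′≤n) h@(_ , r≤n) = ℕ.<⇒≱ (ℕ.≤-reflexive (≡.sym p≡)) $ ℕ.≤-trans
    (ℕ.≤-reflexive (≡.sym (ℕ.m∸n+n≡m (ℕ.<⇒≤ (n%ℕd<d a p)))))
    (ℕ.+-mono-≤ (≡.subst (ℕ._≤ n) (negate-% a (half≇0 h)) r′≤n) r≤n)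

  ¬half⇒half-negate : ∀ {a} → ¬ a ≅ 0ℤ → ¬ Half a → Half (- a)
  ¬half⇒half-negate {a} a≇0 ¬h = ≡.subst (λ r → 1 ℕ.≤ r × r ℕ.≤ n) (≡.sym (negate-% a a≇0))
    ( ℕ.m<n⇒0<n∸m (n%ℕd<d a p)
    , ℕ.m≤n+o⇒m∸n≤o p (a %ℕ p) (≡.subst (ℕ._≤ a %ℕ p ℕ.+ n) (≡.sym p≡)
        (ℕ.+-monoˡ-≤ n (ℕ.≰⇒> λ r≤n → ¬h (1≤% a≇0 , r≤n)))) )

  nonzero? : ∀ a → Dec (¬ a ≅ 0ℤ)
  nonzero? a = ¬? (a ≅? 0ℤ)

  ∏ₚ : (ℤ → ℤ) → ℤ
  ∏ₚ = residueSum *-commutativeMonoid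

  half-when-cong : ∀ {a b x y} → a ≅ b → x ≅ y → when (half? a) x ≅ when (half? b) y
  half-when-cong {a} {b} a≅b x≅y = when-cong (half? a) (half? b) (half-cong a≅b) (half-cong (≅-sym a≅b)) (λ _ → x≅y)

  ∏-between : (g : ℕ → ℤ) (f : ℕ → ℤ) → g 0 ≅ 1ℤ → (∀ i → g (suc i) ≅ f (suc i) ℤ.* g i) →
              ∏ₚ (λ a → when (half? a) (f (a %ℕ p))) ≅ g n
  ∏-between g f g₀ gₛ = ≅-trans
    (sum-cong p λ i → ≅-reflexive (≡.cong (λ r → when (between? n r) (f r)) (lift-% i)))
    (sum-between f g g₀ gₛ n n<p)

  halfProduct : ℤ
  halfProduct = ∏ₚ λ a → when (half? a) a

  halfProduct≅n! : halfProduct ≅ + (n !)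
  halfProduct≅n! = ≅-trans
    (residueSum-cong *-commutativeMonoid λ a → half-when-cong (≅-refl {a}) (≅-sym (%-≅ a)))
    (∏-between (λ i → + (i !)) +_ ≅-refl λ i → ≅-reflexive (ℤ.pos-* (suc i) (i !)))

  halfSign : ∏ₚ (λ a → when (half? a) -1ℤ) ≅ -1ℤ ℤ.^ n
  halfSign = ∏-between (-1ℤ ℤ.^_) (λ _ → -1ℤ) ≅-refl (λ _ → ≅-refl)

  -- As n ≥ 1, the residue 1 lies in the half-system, and its negative would lie there too.
  -1≇1 : ¬ -1ℤ ≅ 1ℤ
  -1≇1 e = half-negate⇒¬half {1ℤ} (half-cong (≅-sym e) h) h
    where
    h : Half 1ℤ
    h = ≡.subst (λ r → 1 ℕ.≤ r × r ℕ.≤ n) (≡.sym (%-unique (ℕ.≤-<-trans 1≤n n<p) ≅-refl)) (ℕ.≤-refl , 1≤n)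

  inverses-product : ∀ a b → when (a ℤ.* b ≅? 1ℤ) a ℤ.* when (b ℤ.* a ≅? 1ℤ) b ≅ 1ℤ
  inverses-product a b = by-cases (a ℤ.* b ≅? 1ℤ)
    where
    by-cases : Dec (a ℤ.* b ≅ 1ℤ) → when (a ℤ.* b ≅? 1ℤ) a ℤ.* when (b ℤ.* a ≅? 1ℤ) b ≅ 1ℤ
    by-cases (yes ab≅1) = ≅-trans
      (*-cong (when-yes (a ℤ.* b ≅? 1ℤ) {a} ab≅1)
              (when-yes (b ℤ.* a ≅? 1ℤ) {b} (≅-trans (≅-reflexive (ℤ.*-comm b a)) ab≅1)))
      ab≅1
    by-cases (no ab≇1) = *-cong
      (when-no (a ℤ.* b ≅? 1ℤ) {a} ab≇1)
      (when-no (b ℤ.* a ≅? 1ℤ) {b} (ab≇1 ∘ ≅-trans (≅-reflexive (ℤ.*-comm a b))))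

  ∏-inverses : ∀ a → ∏ₚ (λ b → when (a ℤ.* b ≅? 1ℤ) a) ≅ when (nonzero? a) a
  ∏-inverses a = by-cases (a ≅? 0ℤ)
    where
    f : ℤ → ℤ
    f b = when (a ℤ.* b ≅? 1ℤ) a

    f-cong : ∀ {b c} → b ≅ c → f b ≅ f c
    f-cong {b} {c} b≅c = when-cong (a ℤ.* b ≅? 1ℤ) (a ℤ.* c ≅? 1ℤ)
      (≅-trans (*-cong (≅-refl {a}) (≅-sym b≅c))) (≅-trans (*-cong (≅-refl {a}) b≅c)) {a} {a} (λ _ → ≅-refl)

    no-inverse : a ≅ 0ℤ → ∀ b → ¬ a ℤ.* b ≅ 1ℤ
    no-inverse a≅0 b ab≅1 = 1≇0 (≅-trans (≅-sym ab≅1) (*-cong a≅0 (≅-refl {b})))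

    by-cases : Dec (a ≅ 0ℤ) → ∏ₚ f ≅ when (nonzero? a) a
    by-cases (yes a≅0) = ≅-trans
      (sum-ε p λ i → when-no (a ℤ.* lift i ≅? 1ℤ) {a} (no-inverse a≅0 (lift i)))
      (≅-sym (when-no (nonzero? a) {a} (λ a≇0 → a≇0 a≅0)))
    by-cases (no a≇0) = ≅-trans
      (residueSum-single *-commutativeMonoid f f-cong b λ c c≇b →
        when-no (a ℤ.* c ≅? 1ℤ) {a} λ ac≅1 → c≇b (inverse-unique {a} {c} {b} ac≅1 ab≅1))
      (≅-trans (when-yes (a ℤ.* b ≅? 1ℤ) {a} ab≅1) (≅-sym (when-yes (nonzero? a) {a} a≇0)))
      where
      b : ℤ
      b = proj₁ (inverse a a≇0)

      ab≅1 : a ℤ.* b ≅ 1ℤ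
      ab≅1 = ≅-trans (≅-reflexive (ℤ.*-comm a b)) (proj₂ (inverse a a≇0))

  ≅-from-difference : ∀ {a b} → a ℤ.- b ≅ 0ℤ → a ≅ b
  ≅-from-difference e = [ ≅0⇒∣ e ]

  -- The roots come from (a - 1)(a + 1) ≅ 0. The disjunction of the two conditions may be written as
  -- a product of two conditional factors because 1 and -1 are distinct, so that at most one factor
  -- is active.
  square-roots-of-1 : ∀ a → when (a ℤ.* a ≅? 1ℤ) a ≅ when (a ≅? 1ℤ) a ℤ.* when (a ≅? -1ℤ) a
  square-roots-of-1 a = by-cases (a ≅? 1ℤ) (a ≅? -1ℤ)
    where
    neither : ¬ a ≅ 1ℤ → ¬ a ≅ -1ℤ → ¬ a ℤ.* a ≅ 1ℤ
    neither a≇1 a≇-1 aa≅1 = [ a≇1 ∘ ≅-from-difference , a≇-1 ∘ ≅-from-difference ]′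
      (*-zero {a ℤ.- 1ℤ} {a ℤ.- -1ℤ} (≅-trans
        (≅-reflexive (solve 1 (λ a → (a :- con 1ℤ) :* (a :- con -1ℤ) := a :* a :- con 1ℤ) ≡.refl a))
        (+-cong aa≅1 (≅-refl { -1ℤ }))))

    by-cases : Dec (a ≅ 1ℤ) → Dec (a ≅ -1ℤ) →
               when (a ℤ.* a ≅? 1ℤ) a ≅ when (a ≅? 1ℤ) a ℤ.* when (a ≅? -1ℤ) a
    by-cases (yes e) (yes f) = contradiction (≅-trans (≅-sym f) e) -1≇1
    by-cases (yes e) (no f)  = ≅-trans (when-yes (a ℤ.* a ≅? 1ℤ) {a} (*-cong e e)) (≅-sym (≅-trans
      (*-cong (when-yes (a ≅? 1ℤ) {a} e) (when-no (a ≅? -1ℤ) {a} f)) (≅-reflexive (ℤ.*-identityʳ a))))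
    by-cases (no e)  (yes f) = ≅-trans (when-yes (a ℤ.* a ≅? 1ℤ) {a} (*-cong f f)) (≅-sym (≅-trans
      (*-cong (when-no (a ≅? 1ℤ) {a} e) (when-yes (a ≅? -1ℤ) {a} f)) (≅-reflexive (ℤ.*-identityˡ a))))
    by-cases (no e)  (no f)  = ≅-trans (when-no (a ℤ.* a ≅? 1ℤ) {a} (neither e f)) (≅-sym
      (*-cong (when-no (a ≅? 1ℤ) {a} e) (when-no (a ≅? -1ℤ) {a} f)))

  when-at-cong : ∀ c → (∀ {a b} → a ≅ b → when (a ≅? c) a ≅ when (b ≅? c) b)
  when-at-cong c {a} {b} a≅b = when-cong (a ≅? c) (b ≅? c) (≅-trans (≅-sym a≅b)) (≅-trans a≅b) {a} {b} (λ _ → a≅b)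

  ∏-at : ∀ c → ∏ₚ (λ a → when (a ≅? c) a) ≅ c
  ∏-at c = ≅-trans
    (residueSum-single *-commutativeMonoid (λ a → when (a ≅? c) a) (when-at-cong c) c λ a → when-no (a ≅? c) {a})
    (when-yes (c ≅? c) {c} ≅-refl)

  -- Consider the matrix with entry `a` at (a, b) if `a * b ≅ 1`, and 1 otherwise. By `∏-inverses`
  -- the product of row `a` is `a`, or 1 for the zero row. Transposed entries multiply to 1, so the
  -- diagonal remains, where `a * a ≅ 1`.
  wilson : ∏ₚ (λ a → when (nonzero? a) a) ≅ -1ℤ
  wilson = begin
    ∏ₚ (λ a → when (nonzero? a) a)
      ≈⟨ residueSum-cong *-commutativeMonoid ∏-inverses ⟨
    ∏ₚ (λ a → ∏ₚ λ b → when (a ℤ.* b ≅? 1ℤ) a)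
      ≈⟨ sum-antisym (λ i j → when (lift i ℤ.* lift j ≅? 1ℤ) (lift i))
           (λ i j _ → inverses-product (lift i) (lift j)) ⟩
    ∏ₚ (λ a → when (a ℤ.* a ≅? 1ℤ) a)
      ≈⟨ residueSum-cong *-commutativeMonoid square-roots-of-1 ⟩
    ∏ₚ (λ a → when (a ≅? 1ℤ) a ℤ.* when (a ≅? -1ℤ) a)
      ≈⟨ sum-distrib p (λ i → when (lift i ≅? 1ℤ) (lift i)) (λ i → when (lift i ≅? -1ℤ) (lift i)) ⟩
    ∏ₚ (λ a → when (a ≅? 1ℤ) a) ℤ.* ∏ₚ (λ a → when (a ≅? -1ℤ) a)
      ≈⟨ *-cong (∏-at 1ℤ) (∏-at -1ℤ) ⟩
    -1ℤ ∎
    where open ≅-Reasoning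

  halves : ∀ a → when (nonzero? a) a ≅ when (half? a) a ℤ.* when (half? (- a)) a
  halves a = by-cases (a ≅? 0ℤ) (half? a)
    where
    by-cases : Dec (a ≅ 0ℤ) → Dec (Half a) →
               when (nonzero? a) a ≅ when (half? a) a ℤ.* when (half? (- a)) a
    by-cases (yes a≅0) _ = ≅-trans (when-no (nonzero? a) {a} (λ a≇0 → a≇0 a≅0)) (≅-sym (*-cong
      (when-no (half? a) {a} (λ h → half≇0 h a≅0))
      (when-no (half? (- a)) {a} (λ h → half≇0 h (neg-cong a≅0)))))
    by-cases (no a≇0) (yes h) = ≅-trans (when-yes (nonzero? a) {a} a≇0) (≅-sym (≅-trans
      (*-cong (when-yes (half? a) {a} h) (when-no (half? (- a)) {a} (λ h′ → half-negate⇒¬half {a} h′ h)))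
      (≅-reflexive (ℤ.*-identityʳ a))))
    by-cases (no a≇0) (no ¬h) = ≅-trans (when-yes (nonzero? a) {a} a≇0) (≅-sym (≅-trans
      (*-cong (when-no (half? a) {a} ¬h) (when-yes (half? (- a)) {a} (¬half⇒half-negate a≇0 ¬h)))
      (≅-reflexive (ℤ.*-identityˡ a))))

  -- The nonzero residues are the half-system and its negatives, so Wilson's theorem reads
  -- `F * (s * F) ≅ -1` with s = (-1)^n. Multiplying by `s`, whose square is 1, isolates `F * F`.
  halfProduct² : halfProduct ℤ.* halfProduct ≅ -1ℤ ℤ.^ suc n
  halfProduct² = begin
    F ℤ.* F                        ≡⟨ ℤ.*-identityˡ (F ℤ.* F) ⟨
    1ℤ ℤ.* (F ℤ.* F)               ≡⟨ ≡.cong (ℤ._* (F ℤ.* F)) ([-1]^n*[-1]^n≡1 n) ⟨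
    s ℤ.* s ℤ.* (F ℤ.* F)          ≡⟨ solve 2 (λ s F → s :* s :* (F :* F) := F :* (s :* F) :* s) ≡.refl s F ⟩
    F ℤ.* (s ℤ.* F) ℤ.* s          ≈⟨ *-cong whole (≅-refl {s}) ⟩
    -1ℤ ℤ.^ suc n                  ∎
    where
    open ≅-Reasoning

    F = halfProduct
    s = -1ℤ ℤ.^ n

    negated : ∏ₚ (λ a → when (half? (- a)) a) ≅ s ℤ.* F
    negated = begin
      ∏ₚ (λ a → when (half? (- a)) a)
        ≈⟨ residueSum-cong *-commutativeMonoid (λ a → half-when-cong (≅-refl {(- a)})
             (≅-reflexive (≡.sym (ℤ.neg-involutive a)))) ⟩
      ∏ₚ (λ a → when (half? (- a)) (- - a))
        ≈⟨ reindex-negate *-commutativeMonoid (λ a → when (half? a) (- a))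
             (λ a≅b → half-when-cong a≅b (neg-cong a≅b)) ⟨
      ∏ₚ (λ a → when (half? a) (- a))
        ≈⟨ residueSum-cong *-commutativeMonoid (λ a → half-when-cong (≅-refl {a})
             (≅-reflexive (≡.sym (ℤ.-1*i≡-i a)))) ⟩
      ∏ₚ (λ a → when (half? a) (-1ℤ ℤ.* a))
        ≈⟨ residueSum-cong *-commutativeMonoid (λ a → when-∙ (half? a) -1ℤ a) ⟩
      ∏ₚ (λ a → when (half? a) -1ℤ ℤ.* when (half? a) a)
        ≈⟨ sum-distrib p (λ i → when (half? (lift i)) -1ℤ) (λ i → when (half? (lift i)) (lift i)) ⟩
      ∏ₚ (λ a → when (half? a) -1ℤ) ℤ.* F
        ≈⟨ *-cong halfSign (≅-refl {F}) ⟩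
      s ℤ.* F ∎

    whole : F ℤ.* (s ℤ.* F) ≅ -1ℤ
    whole = begin
      F ℤ.* (s ℤ.* F)
        ≈⟨ *-cong (≅-refl {F}) negated ⟨
      F ℤ.* ∏ₚ (λ a → when (half? (- a)) a)
        ≈⟨ sum-distrib p (λ i → when (half? (lift i)) (lift i)) (λ i → when (half? (- lift i)) (lift i)) ⟨
      ∏ₚ (λ a → when (half? a) a ℤ.* when (half? (- a)) a)
        ≈⟨ residueSum-cong *-commutativeMonoid halves ⟨
      ∏ₚ (λ a → when (nonzero? a) a)
        ≈⟨ wilson ⟩
      -1ℤ ∎

  -- Scaling-invariant relations on the nonzero residues: counting related pairs by their
  -- difference.

  module Related
    (R : ℤ → ℤ → Set) (R? : ∀ a b → Dec (R a b))
    (R-resp : ∀ {a a′ b b′} → a ≅ a′ → b ≅ b′ → R a b → R a′ b′)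
    (R-sym : ∀ {a b} → R a b → R b a)
    (R-scale : ∀ {a b} c → ¬ c ≅ 0ℤ → R a b → R (c ℤ.* a) (c ℤ.* b))
    (R-refl : ∀ {a} → ¬ a ≅ 0ℤ → R a a)
    (R-nonzero : ∀ {a b} → R a b → ¬ a ≅ 0ℤ)
    where

    -1≇0 : ¬ -1ℤ ≅ 0ℤ
    -1≇0 e = 1≇0 (neg-cong e)

    R-unscale : ∀ {a b} c → ¬ c ≅ 0ℤ → R (c ℤ.* a) (c ℤ.* b) → R a b
    R-unscale {a} {b} c c≇0 r = R-resp (cancel a) (cancel b) (R-scale d d≇0 r)
      where
      d : ℤ
      d = proj₁ (inverse c c≇0)

      dc≅1 : d ℤ.* c ≅ 1ℤ
      dc≅1 = proj₂ (inverse c c≇0)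

      d≇0 : ¬ d ≅ 0ℤ
      d≇0 d≅0 = 1≇0 (≅-trans (≅-sym dc≅1) (*-cong d≅0 (≅-refl {c})))

      cancel : ∀ a → d ℤ.* (c ℤ.* a) ≅ a
      cancel a = ≅-trans (≅-reflexive (≡.sym (ℤ.*-assoc d c a)))
        (≅-trans (*-cong dc≅1 (≅-refl {a})) (≅-reflexive (ℤ.*-identityˡ a)))

    R-negate : ∀ {a b} → R a b → R (- a) (- b)
    R-negate {a} {b} r = R-resp (≅-reflexive (ℤ.-1*i≡-i a)) (≅-reflexive (ℤ.-1*i≡-i b)) (R-scale -1ℤ -1≇0 r)

    -- For the relation of lying in the same coset of H this is the sum of the diagonal cyclotomic
    -- numbers (i, i).
    neighbours : ℕ
    neighbours = residueSum ℕ.+-0-commutativeMonoid λ a → Count.when (R? a (1ℤ ℤ.+ a)) 1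

    module _ {c ℓ} (M : CommutativeMonoid c ℓ) where
      open CommutativeMonoid M using (Carrier; _≈_; refl; sym; trans)
      private module B = BigOperator M

      sum-over-differences : (f : ℤ → ℤ → Carrier) → (∀ {a b c} → b ≅ c → f a b ≈ f a c) →
        residueSum M (λ a → residueSum M (f a)) ≈ residueSum M (λ d → residueSum M λ a → f a (d ℤ.+ a))
      sum-over-differences f f-cong = trans
        (residueSum-cong M λ a → reindex-shift M (f a) f-cong a)
        (B.∑-comm {p} {p} (λ i j → f (lift i) (lift j ℤ.+ lift i)))

      -- Substituting `d * a` for `a` gives the pair `d * a`, `d * (1 + a)`, and cancelling `d`
      -- leaves a pair of difference 1. The lemma serves twice: with `v = 1` in ℕ for the double
      -- count, and with a factor of the product as `v`.
      sum-at-difference : ∀ v d → ¬ d ≅ 0ℤ →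
        residueSum M (λ a → B.when (R? a (d ℤ.+ a)) v) ≈ neighbours B.• v
      sum-at-difference v d d≇0 = trans
        (reindex-scale M (λ a → B.when (R? a (d ℤ.+ a)) v)
          (λ {a} {b} a≅b → B.when-cong (R? a (d ℤ.+ a)) (R? b (d ℤ.+ b))
            (R-resp a≅b (+-cong (≅-refl {d}) a≅b))
            (R-resp (≅-sym a≅b) (+-cong (≅-refl {d}) (≅-sym a≅b)))
            {v} {v} (λ _ → refl))
          d (proj₁ (inverse d d≇0)) (proj₂ (inverse d d≇0)))
        (trans
          (residueSum-cong M λ a → B.when-cong (R? (d ℤ.* a) (d ℤ.+ d ℤ.* a)) (R? a (1ℤ ℤ.+ a))
            (R-unscale d d≇0 ∘ R-resp (≅-refl {d ℤ.* a}) (≅-reflexive (factor a)))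
            (R-resp (≅-refl {d ℤ.* a}) (≅-reflexive (≡.sym (factor a))) ∘ R-scale d d≇0)
            {v} {v} (λ _ → refl))
          (B.sum-when-const p (λ i → R? (lift i) (1ℤ ℤ.+ lift i)) v))
        where
        factor : ∀ a → d ℤ.+ d ℤ.* a ≡ d ℤ.* (1ℤ ℤ.+ a)
        factor a = solve 2 (λ d a → d :+ d :* a := d :* (con 1ℤ :+ a)) ≡.refl d a

    nonzero-count : residueSum ℕ.+-0-commutativeMonoid (λ a → Count.when (nonzero? a) 1) ≡ n ℕ.+ n
    nonzero-count = ≡.trans
      (Count.sum-cong p λ i → Count.when-cong (nonzero? (lift i)) (between? (n ℕ.+ n) (toℕ i))
        (λ i≇0 → ℕ.n≢0⇒n>0 (λ i≡0 → i≇0 (≅-reflexive (≡.cong +_ i≡0)))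
               , ℕ.≤-pred (≡.subst (toℕ i ℕ.<_) p≡ (Fin.toℕ<n i)))
        (λ (1≤i , _) i≅0 → ℕ.n>0⇒n≢0 1≤i (small-≅⇒≡ (Fin.toℕ<n i) (ℕ.≤-<-trans ℕ.z≤n n<p) i≅0))
        {1} {1} (λ _ → ≡.refl))
      (Count.sum-between {p} (λ _ → 1) (λ i → i) ≡.refl (λ _ → ≡.refl) (n ℕ.+ n)
        (ℕ.≤-reflexive (≡.sym p≡)))

    •≡* : ∀ i j → i Count.• j ≡ i ℕ.* j
    •≡* zero    j = ≡.refl
    •≡* (suc i) j = ≡.cong (j ℕ.+_) (•≡* i j)

    ℕ-sum : (ℤ → ℕ) → ℕ
    ℕ-sum = residueSum ℕ.+-0-commutativeMonoid

    ℕ-sum-nonzero : ∀ v → ℕ-sum (λ a → Count.when (nonzero? a) v) ≡ (n ℕ.+ n) ℕ.* v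
    ℕ-sum-nonzero v = ≡.trans (Count.sum-when-const p (nonzero? ∘ lift) v)
      (≡.trans (•≡* (ℕ-sum λ a → Count.when (nonzero? a) 1) v) (≡.cong (ℕ._* v) nonzero-count))

    -- Both sides count the related pairs of nonzero residues: by first entry and by difference.
    degree≡1+neighbours : ∀ k →
      (∀ a → ¬ a ≅ 0ℤ → ℕ-sum (λ b → Count.when (R? a b) 1) ≡ k) → k ≡ suc neighbours
    degree≡1+neighbours k degree = ℕ.*-cancelˡ-≡ k (suc neighbours) (n ℕ.+ n) {{ℕ.>-nonZero (ℕ.m≤n⇒m≤n+o n 1≤n)}} (begin
      (n ℕ.+ n) ℕ.* k
        ≡⟨ ℕ-sum-nonzero k ⟨
      ℕ-sum (λ a → Count.when (nonzero? a) k)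
        ≡⟨ Count.sum-cong p (λ i → row (lift i) (lift i ≅? 0ℤ)) ⟨
      ℕ-sum (λ a → ℕ-sum λ b → Count.when (R? a b) 1)
        ≡⟨ sum-over-differences ℕ.+-0-commutativeMonoid (λ a b → Count.when (R? a b) 1)
             (λ {a} {b} {c} b≅c → Count.when-cong (R? a b) (R? a c)
               (R-resp (≅-refl {a}) b≅c) (R-resp (≅-refl {a}) (≅-sym b≅c)) {1} {1} (λ _ → ≡.refl)) ⟩
      ℕ-sum (λ d → ℕ-sum λ a → Count.when (R? a (d ℤ.+ a)) 1)
        ≡⟨ Count.sum-cong p (λ i → diagonal (lift i) (lift i ≅? 0ℤ)) ⟩
      ℕ-sum (λ d → Count.when (d ≅? 0ℤ) (n ℕ.+ n) ℕ.+ Count.when (nonzero? d) neighbours)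
        ≡⟨ Count.sum-distrib p (λ i → Count.when (lift i ≅? 0ℤ) (n ℕ.+ n)) (λ i → Count.when (nonzero? (lift i)) neighbours) ⟩
      ℕ-sum (λ d → Count.when (d ≅? 0ℤ) (n ℕ.+ n)) ℕ.+ ℕ-sum (λ d → Count.when (nonzero? d) neighbours)
        ≡⟨ ≡.cong₂ ℕ._+_ zero-term (ℕ-sum-nonzero neighbours) ⟩
      (n ℕ.+ n) ℕ.+ (n ℕ.+ n) ℕ.* neighbours
        ≡⟨ ℕ.*-suc (n ℕ.+ n) neighbours ⟨
      (n ℕ.+ n) ℕ.* suc neighbours ∎)
      where
      open ≡.≡-Reasoning

      row : ∀ a → Dec (a ≅ 0ℤ) → ℕ-sum (λ b → Count.when (R? a b) 1) ≡ Count.when (nonzero? a) k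
      row a (yes a≅0) = ≡.trans
        (Count.sum-ε p λ i → Count.when-no (R? a (lift i)) {1} λ r → R-nonzero r a≅0)
        (≡.sym (Count.when-no (nonzero? a) {k} λ a≇0 → a≇0 a≅0))
      row a (no a≇0) = ≡.trans (degree a a≇0) (≡.sym (Count.when-yes (nonzero? a) {k} a≇0))

      -- Difference 0 gives the pair (a, a) for each nonzero a, hence `n + n` pairs: these account
      -- for the `suc` in the result.
      diagonal : ∀ d → Dec (d ≅ 0ℤ) → ℕ-sum (λ a → Count.when (R? a (d ℤ.+ a)) 1) ≡
                 Count.when (d ≅? 0ℤ) (n ℕ.+ n) ℕ.+ Count.when (nonzero? d) neighbours
      diagonal d (yes d≅0) = ≡.trans
        (≡.trans
          (Count.sum-cong p λ i → Count.when-cong (R? (lift i) (d ℤ.+ lift i)) (nonzero? (lift i))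
            R-nonzero
            (λ i≇0 → R-resp ≅-refl
              (≅-trans (≅-reflexive (≡.sym (ℤ.+-identityˡ (lift i)))) (+-cong (≅-sym d≅0) (≅-refl {lift i})))
              (R-refl i≇0))
            {1} {1} (λ _ → ≡.refl))
          nonzero-count)
        (≡.sym (≡.trans
          (≡.cong₂ ℕ._+_ (Count.when-yes (d ≅? 0ℤ) {n ℕ.+ n} d≅0)
            (Count.when-no (nonzero? d) {neighbours} λ d≇0 → d≇0 d≅0))
          (ℕ.+-identityʳ (n ℕ.+ n))))
      diagonal d (no d≇0) = ≡.trans
        (sum-at-difference ℕ.+-0-commutativeMonoid 1 d d≇0)
        (≡.trans (≡.trans (•≡* neighbours 1) (ℕ.*-identityʳ neighbours))
          (≡.sym (≡.cong₂ ℕ._+_ (Count.when-no (d ≅? 0ℤ) {n ℕ.+ n} d≇0)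
            (Count.when-yes (nonzero? d) {neighbours} d≇0))))

      zero-term : ℕ-sum (λ d → Count.when (d ≅? 0ℤ) (n ℕ.+ n)) ≡ n ℕ.+ n
      zero-term = ≡.trans
        (residueSum-single ℕ.+-0-commutativeMonoid (λ d → Count.when (d ≅? 0ℤ) (n ℕ.+ n))
          (λ {a} {b} a≅b → Count.when-cong (a ≅? 0ℤ) (b ≅? 0ℤ) (≅-trans (≅-sym a≅b)) (≅-trans a≅b)
            {n ℕ.+ n} {n ℕ.+ n} (λ _ → ≡.refl))
          0ℤ (λ d → Count.when-no (d ≅? 0ℤ) {n ℕ.+ n}))
        (Count.when-yes (0ℤ ≅? 0ℤ) {n ℕ.+ n} ≅-refl)

    •≡^ : ∀ i v → i • v ≡ v ℤ.^ i
    •≡^ zero    v = ≡.refl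
    •≡^ (suc i) v = ≡.cong (v ℤ.*_) (•≡^ i v)

    when-sign² : ∀ {P : Set} (P? : Dec P) → when P? -1ℤ ℤ.* when P? -1ℤ ≅ 1ℤ
    when-sign² (yes _) = ≅-refl
    when-sign² (no _)  = ≅-refl

    -- The parity of `neighbours` decides whether -1 is related to 1.

    2≇0 : ¬ + 2 ≅ 0ℤ
    2≇0 e = -1≇1 (≅-sym (≅-from-difference e))

    n+n≅-1 : + n ℤ.+ + n ≅ -1ℤ
    n+n≅-1 = ≅-from-difference (≅-trans (≅-reflexive (≡.trans
      (≡.cong (ℤ._+ 1ℤ) (≡.sym (ℤ.pos-+ n n)))
      (≡.cong +_ (≡.trans (ℕ.+-comm (n ℕ.+ n) 1) (≡.sym p≡))))) p≅0)

    -- Since 2n + 1 = p, the residue n is -1/2, and 2 can be cancelled.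
    half-unique : ∀ {a} → a ℤ.+ a ≅ -1ℤ → a ≅ + n
    half-unique {a} e = ≅-from-difference ([ (λ 2≅0 → contradiction 2≅0 2≇0) , (λ d → d) ]′
      (*-zero {+ 2} {a ℤ.- + n} (≅-trans
        (≅-reflexive (solve 2 (λ a n → con (+ 2) :* (a :- n) := (a :+ a) :- (n :+ n)) ≡.refl a (+ n)))
        (+-cong e (neg-cong n+n≅-1)))))

    neighbourSign : ℤ → ℤ
    neighbourSign a = when (R? a (1ℤ ℤ.+ a)) -1ℤ

    neighbourSign-cong : ∀ {a b} → a ≅ b → neighbourSign a ≅ neighbourSign b
    neighbourSign-cong {a} {b} a≅b = when-cong (R? a (1ℤ ℤ.+ a)) (R? b (1ℤ ℤ.+ b))
      (R-resp a≅b (+-cong (≅-refl {1ℤ}) a≅b))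
      (R-resp (≅-sym a≅b) (+-cong (≅-refl {1ℤ}) (≅-sym a≅b))) { -1ℤ } { -1ℤ } (λ _ → ≅-refl)

    -- Negating and swapping (a, 1 + a) gives (-1 - a, -a), which is (b, 1 + b) for b = -1 - a.
    neighbourSign-reflect : ∀ {a b} → a ℤ.+ b ≅ -1ℤ → neighbourSign a ≅ neighbourSign b
    neighbourSign-reflect {a} {b} a+b≅-1 = when-cong (R? a (1ℤ ℤ.+ a)) (R? b (1ℤ ℤ.+ b))
      (reflect a+b≅-1) (reflect (≅-trans (≅-reflexive (ℤ.+-comm b a)) a+b≅-1)) { -1ℤ } { -1ℤ } (λ _ → ≅-refl)
      where
      reflect : ∀ {a b} → a ℤ.+ b ≅ -1ℤ → R a (1ℤ ℤ.+ a) → R b (1ℤ ℤ.+ b)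
      reflect {a} {b} a+b≅-1 r = R-resp
        (≅-trans (≅-reflexive (solve 1 (λ a → :- (con 1ℤ :+ a) := con -1ℤ :- a) ≡.refl a)) -1-a≅b)
        (≅-trans (≅-reflexive (solve 1 (λ a → :- a := con 1ℤ :+ (con -1ℤ :- a)) ≡.refl a))
          (+-cong (≅-refl {1ℤ}) -1-a≅b))
        (R-sym (R-negate r))
        where
        -1-a≅b : -1ℤ ℤ.- a ≅ b
        -1-a≅b = ≅-trans (+-cong (≅-sym a+b≅-1) (≅-refl { - a }))
          (≅-reflexive (solve 2 (λ a b → (a :+ b) :- a := b) ≡.refl a b))

    -- The involution a ↦ −1 − a permutes the a related to 1 + a, and its only fixed point is n.
    parity : -1ℤ ℤ.^ neighbours ≅ when (R? 1ℤ -1ℤ) -1ℤ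
    parity = begin
      -1ℤ ℤ.^ neighbours
        ≡⟨ •≡^ neighbours -1ℤ ⟨
      neighbours • -1ℤ
        ≈⟨ sum-when-const p (λ i → R? (lift i) (1ℤ ℤ.+ lift i)) -1ℤ ⟨
      ∏ₚ neighbourSign
        ≈⟨ residueSum-cong *-commutativeMonoid row ⟨
      ∏ₚ (λ a → ∏ₚ λ b → paired a b)
        ≈⟨ sum-antisym (λ i j → paired (lift i) (lift j)) (λ i j _ → cancel (lift i) (lift j) (lift i ℤ.+ lift j ≅? -1ℤ)) ⟩
      ∏ₚ (λ a → paired a a)
        ≈⟨ residueSum-single *-commutativeMonoid (λ a → paired a a) (λ {a} {b} → diagonal-cong {a} {b}) (+ n)
             (λ a a≇n → when-no (a ℤ.+ a ≅? -1ℤ) {neighbourSign a} (a≇n ∘ half-unique)) ⟩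
      paired (+ n) (+ n)
        ≈⟨ when-yes (+ n ℤ.+ + n ≅? -1ℤ) {neighbourSign (+ n)} n+n≅-1 ⟩
      neighbourSign (+ n)
        ≈⟨ when-cong (R? (+ n) (1ℤ ℤ.+ + n)) (R? 1ℤ -1ℤ)
             (R-unscale (+ n) n≇0 ∘ R-resp (≅-reflexive (≡.sym (ℤ.*-identityʳ (+ n)))) 1+n≅-n)
             (R-resp (≅-reflexive (ℤ.*-identityʳ (+ n))) (≅-sym 1+n≅-n) ∘ R-scale (+ n) n≇0)
             { -1ℤ } { -1ℤ } (λ _ → ≅-refl) ⟩
      when (R? 1ℤ -1ℤ) -1ℤ ∎
      where
      open ≅-Reasoning

      paired : ℤ → ℤ → ℤ
      paired a b = when (a ℤ.+ b ≅? -1ℤ) (neighbourSign a)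

      paired-cong : ∀ a {b c} → b ≅ c → paired a b ≅ paired a c
      paired-cong a {b} {c} b≅c = when-cong (a ℤ.+ b ≅? -1ℤ) (a ℤ.+ c ≅? -1ℤ)
        (≅-trans (+-cong (≅-refl {a}) (≅-sym b≅c))) (≅-trans (+-cong (≅-refl {a}) b≅c))
        {neighbourSign a} {neighbourSign a} (λ _ → ≅-refl)

      diagonal-cong : ∀ {a b} → a ≅ b → paired a a ≅ paired b b
      diagonal-cong {a} {b} a≅b = when-cong (a ℤ.+ a ≅? -1ℤ) (b ℤ.+ b ≅? -1ℤ)
        (≅-trans (+-cong (≅-sym a≅b) (≅-sym a≅b))) (≅-trans (+-cong a≅b a≅b))
        {neighbourSign a} {neighbourSign b} (λ _ → neighbourSign-cong a≅b)

      reflection : ∀ a → a ℤ.+ (-1ℤ ℤ.- a) ≅ -1ℤ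
      reflection a = ≅-reflexive (solve 1 (λ a → a :+ (con -1ℤ :- a) := con -1ℤ) ≡.refl a)

      row : ∀ a → ∏ₚ (paired a) ≅ neighbourSign a
      row a = ≅-trans
        (residueSum-single *-commutativeMonoid (paired a) (paired-cong a) (-1ℤ ℤ.- a) λ b b≇ →
          when-no (a ℤ.+ b ≅? -1ℤ) {neighbourSign a} λ e → b≇ (≅-trans
            (≅-reflexive (solve 2 (λ a b → b := (a :+ b) :- a) ≡.refl a b))
            (+-cong e (≅-refl { - a }))))
        (when-yes (a ℤ.+ (-1ℤ ℤ.- a) ≅? -1ℤ) {neighbourSign a} (reflection a))

      cancel : ∀ a b → Dec (a ℤ.+ b ≅ -1ℤ) → paired a b ℤ.* paired b a ≅ 1ℤ
      cancel a b (yes e) = ≅-trans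
        (*-cong (when-yes (a ℤ.+ b ≅? -1ℤ) {neighbourSign a} e)
          (≅-trans (when-yes (b ℤ.+ a ≅? -1ℤ) {neighbourSign b} (≅-trans (≅-reflexive (ℤ.+-comm b a)) e))
            (≅-sym (neighbourSign-reflect {a} {b} e))))
        (when-sign² (R? a (1ℤ ℤ.+ a)))
      cancel a b (no ¬e) = *-cong
        (when-no (a ℤ.+ b ≅? -1ℤ) {neighbourSign a} ¬e)
        (when-no (b ℤ.+ a ≅? -1ℤ) {neighbourSign b} (¬e ∘ ≅-trans (≅-reflexive (ℤ.+-comm a b))))

      n≇0 : ¬ + n ≅ 0ℤ
      n≇0 e = ℕ.n>0⇒n≢0 1≤n (small-≅⇒≡ n<p (ℕ.≤-<-trans ℕ.z≤n n<p) e)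

      1+n≅-n : 1ℤ ℤ.+ + n ≅ + n ℤ.* -1ℤ
      1+n≅-n = ≅-trans
        (≅-reflexive (solve 1 (λ n → con 1ℤ :+ n := (n :+ n) :+ (con 1ℤ :- n)) ≡.refl (+ n)))
        (≅-trans (+-cong n+n≅-1 (≅-refl {1ℤ ℤ.- + n}))
          (≅-reflexive (solve 1 (λ n → con -1ℤ :+ (con 1ℤ :- n) := n :* con -1ℤ) ≡.refl (+ n))))

    -- The sign contributed by related pairs at distance more than n.

    Far : ℤ → ℤ → Set
    Far a b = b %ℕ p ℕ.+ n ℕ.< a %ℕ p

    far? : ∀ a b → Dec (Far a b)
    far? a b = b %ℕ p ℕ.+ n ℕ.<? a %ℕ p

    Close : ℤ → ℤ → Set
    Close a b = a %ℕ p ℕ.+ b %ℕ p ℕ.≤ n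

    close? : ∀ a b → Dec (Close a b)
    close? a b = a %ℕ p ℕ.+ b %ℕ p ℕ.≤? n

    -- With residues x of `a` and y of `b`, the hypothesis says y + n < p - x, and p = 2n + 1 turns
    -- this into x + y ≤ n. This form of the condition is symmetric in `a` and `b`, which `Far` is
    -- not. For `a` congruent to 0 the residue of `- a` would be 0 and not p - x.
    far-negate⇒close : ∀ {a b} → ¬ a ≅ 0ℤ → Far (- a) b → Close a b
    far-negate⇒close {a} {b} a≇0 far = ℕ.+-cancelʳ-≤ n (x ℕ.+ y) n (ℕ.≤-pred (begin-strict
      x ℕ.+ y ℕ.+ n        ≡⟨ ℕ.+-assoc x y n ⟩
      x ℕ.+ (y ℕ.+ n)      <⟨ ℕ.+-monoʳ-< x (≡.subst (y ℕ.+ n ℕ.<_) (negate-% a a≇0) far) ⟩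
      x ℕ.+ (p ℕ.∸ x)      ≡⟨ ℕ.m+[n∸m]≡n (ℕ.<⇒≤ (n%ℕd<d a p)) ⟩
      p                    ≡⟨ p≡ ⟩
      suc (n ℕ.+ n)        ∎))
      where
      open ℕ.≤-Reasoning
      x = a %ℕ p
      y = b %ℕ p

    close⇒far-negate : ∀ {a b} → ¬ a ≅ 0ℤ → Close a b → Far (- a) b
    close⇒far-negate {a} {b} a≇0 close = ≡.subst (y ℕ.+ n ℕ.<_) (≡.sym (negate-% a a≇0))
      (ℕ.+-cancelˡ-< x (y ℕ.+ n) (p ℕ.∸ x) (begin-strict
        x ℕ.+ (y ℕ.+ n)      ≡⟨ ℕ.+-assoc x y n ⟨
        x ℕ.+ y ℕ.+ n        ≤⟨ ℕ.+-monoˡ-≤ n close ⟩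
        n ℕ.+ n              <⟨ ℕ.n<1+n (n ℕ.+ n) ⟩
        suc (n ℕ.+ n)        ≡⟨ p≡ ⟨
        p                    ≡⟨ ℕ.m+[n∸m]≡n (ℕ.<⇒≤ (n%ℕd<d a p)) ⟨
        x ℕ.+ (p ℕ.∸ x)      ∎))
      where
      open ℕ.≤-Reasoning
      x = a %ℕ p
      y = b %ℕ p

    farSign : ℤ → ℤ → ℤ
    farSign a b = when (far? a b) -1ℤ

    -- `Far` puts the larger residue first, so each unordered pair contributes its sign only once
    -- although the product runs over ordered pairs.
    farProduct : ℤ
    farProduct = ∏ₚ λ a → ∏ₚ λ b → when (R? a b) (farSign a b)

    closeSign : ℤ → ℤ → ℤ
    closeSign a b = when (R? (- a) b) (when (close? a b) -1ℤ)

    R-negateˡ : ∀ {a b} → R (- a) b → R (- b) a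
    R-negateˡ {a} {b} r = R-sym (R-resp (≅-reflexive (ℤ.neg-involutive a)) (≅-refl { - b }) (R-negate r))

    closeSign-sym : ∀ a b → closeSign a b ≅ closeSign b a
    closeSign-sym a b = when-cong (R? (- a) b) (R? (- b) a) R-negateˡ R-negateˡ
      {when (close? a b) -1ℤ} {when (close? b a) -1ℤ} λ _ →
      when-cong (close? a b) (close? b a)
        (≡.subst (ℕ._≤ n) (ℕ.+-comm (a %ℕ p) (b %ℕ p))) (≡.subst (ℕ._≤ n) (ℕ.+-comm (b %ℕ p) (a %ℕ p)))
        { -1ℤ } { -1ℤ } (λ _ → ≅-refl)

    closeSign² : ∀ a b → closeSign a b ℤ.* closeSign a b ≅ 1ℤ
    closeSign² a b = by-cases (R? (- a) b)
      where
      by-cases : Dec (R (- a) b) → closeSign a b ℤ.* closeSign a b ≅ 1ℤ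
      by-cases (yes r) = ≅-trans
        (*-cong (when-yes (R? (- a) b) {when (close? a b) -1ℤ} r) (when-yes (R? (- a) b) {when (close? a b) -1ℤ} r))
        (when-sign² (close? a b))
      by-cases (no ¬r) =
        *-cong (when-no (R? (- a) b) {when (close? a b) -1ℤ} ¬r) (when-no (R? (- a) b) {when (close? a b) -1ℤ} ¬r)

    -- With (x, y) = (-a, b), the involution (x, y) ↦ (p - y, p - x) is the exchange of a and b. The
    -- matrix `closeSign` is symmetric with entries ±1, so transposed entries cancel.
    farProduct≅diagonal : farProduct ≅ ∏ₚ (λ a → closeSign a a)
    farProduct≅diagonal = begin
      farProduct
        ≈⟨ reindex-negate *-commutativeMonoid (λ a → ∏ₚ λ b → when (R? a b) (farSign a b))
             (λ {a} {a′} a≅a′ → sum-cong p λ j → row-cong (lift j) a≅a′) ⟩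
      ∏ₚ (λ a → ∏ₚ λ b → when (R? (- a) b) (farSign (- a) b))
        ≈⟨ residueSum-cong *-commutativeMonoid (λ a → residueSum-cong *-commutativeMonoid λ b →
             when-congʳ (R? (- a) b) {farSign (- a) b} {when (close? a b) -1ℤ} (to-close a b)) ⟩
      ∏ₚ (λ a → ∏ₚ λ b → closeSign a b)
        ≈⟨ sum-antisym (λ i j → closeSign (lift i) (lift j)) (λ i j _ → ≅-trans
             (*-cong (≅-refl {closeSign (lift i) (lift j)}) (closeSign-sym (lift j) (lift i)))
             (closeSign² (lift i) (lift j))) ⟩
      ∏ₚ (λ a → closeSign a a) ∎
      where
      open ≅-Reasoning

      row-cong : ∀ b {a a′} → a ≅ a′ → when (R? a b) (farSign a b) ≅ when (R? a′ b) (farSign a′ b)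
      row-cong b {a} {a′} a≅a′ = when-cong (R? a b) (R? a′ b)
        (R-resp a≅a′ (≅-refl {b})) (R-resp (≅-sym a≅a′) (≅-refl {b})) {farSign a b} {farSign a′ b} λ _ →
        ≅-reflexive (≡.cong (λ r → when (b %ℕ p ℕ.+ n ℕ.<? r) -1ℤ) (%-cong a≅a′))

      to-close : ∀ a b → R (- a) b → farSign (- a) b ≅ when (close? a b) -1ℤ
      to-close a b r = when-cong (far? (- a) b) (close? a b)
        (far-negate⇒close {a} {b} a≇0) (close⇒far-negate {a} {b} a≇0) { -1ℤ } { -1ℤ } (λ _ → ≅-refl)
        where
        a≇0 : ¬ a ≅ 0ℤ
        a≇0 a≅0 = R-nonzero r (neg-cong a≅0)

    R-minus : R 1ℤ -1ℤ → ∀ {a} → ¬ a ≅ 0ℤ → R (- a) a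
    R-minus r {a} a≇0 = R-resp
      (≅-reflexive (solve 1 (λ a → a :* con -1ℤ := :- a) ≡.refl a)) (≅-reflexive (ℤ.*-identityʳ a))
      (R-sym (R-scale a a≇0 r))

    -- If -1 is related to 1, every nonzero a is related to -a, and the diagonal contributes one
    -- sign for each residue a ≥ 1 with 2a ≤ n, that is for 1, ..., ⌊n/2⌋.
    farProduct-symmetric : R 1ℤ -1ℤ → farProduct ≅ -1ℤ ℤ.^ (n ℕ./ 2)
    farProduct-symmetric r = ≅-trans farProduct≅diagonal (≅-trans
      (sum-cong p λ i → diagonal i (lift i ≅? 0ℤ))
      (sum-between (λ _ → -1ℤ) (-1ℤ ℤ.^_) ≅-refl (λ _ → ≅-refl) (n ℕ./ 2)
        (ℕ.≤-<-trans (ℕ.m/n≤m n 2) n<p)))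
      where
      halve : ∀ {a} → a ℕ.+ a ℕ.≤ n → a ℕ.≤ n ℕ./ 2
      halve {a} 2a≤n = ≡.subst (ℕ._≤ n ℕ./ 2) (≡.trans (≡.cong (ℕ._/ 2) (a+a≡a*2 a)) (ℕ.m*n/n≡m a 2)) (ℕ./-monoˡ-≤ 2 2a≤n)
        where
        a+a≡a*2 : ∀ a → a ℕ.+ a ≡ a ℕ.* 2
        a+a≡a*2 a = ≡.trans (≡.cong (a ℕ.+_) (≡.sym (ℕ.+-identityʳ a))) (ℕ.*-comm 2 a)

      double : ∀ {a} → a ℕ.≤ n ℕ./ 2 → a ℕ.+ a ℕ.≤ n
      double {a} a≤n/2 = ℕ.≤-trans (ℕ.+-mono-≤ a≤n/2 (ℕ.≤-trans a≤n/2 (ℕ.m≤m+n (n ℕ./ 2) 0)))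
        (ℕ.≤-trans (ℕ.≤-reflexive (ℕ.*-comm 2 (n ℕ./ 2))) (ℕ.m/n*n≤m n 2))

      diagonal : ∀ i → Dec (lift i ≅ 0ℤ) → closeSign (lift i) (lift i) ≅ when (between? (n ℕ./ 2) (toℕ i)) -1ℤ
      diagonal i (yes i≅0) = ≅-trans
        (when-no (R? (- lift i) (lift i)) {when (close? (lift i) (lift i)) -1ℤ} λ r → R-nonzero (R-sym r) i≅0)
        (≅-sym (when-no (between? (n ℕ./ 2) (toℕ i)) { -1ℤ } λ (1≤i , _) →
          ℕ.n>0⇒n≢0 1≤i (≡.trans (≡.sym (lift-% i)) (%≡0 i≅0))))
      diagonal i (no i≇0) = ≅-trans
        (when-yes (R? (- lift i) (lift i)) {when (close? (lift i) (lift i)) -1ℤ} (R-minus r i≇0))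
        (when-cong (close? (lift i) (lift i)) (between? (n ℕ./ 2) (toℕ i))
          (λ c → ≡.subst (1 ℕ.≤_) (lift-% i) (1≤% i≇0)
               , halve (≡.subst (λ r → r ℕ.+ r ℕ.≤ n) (lift-% i) c))
          (λ (_ , i≤) → ≡.subst (λ r → r ℕ.+ r ℕ.≤ n) (≡.sym (lift-% i)) (double i≤))
          { -1ℤ } { -1ℤ } (λ _ → ≅-refl))

    farProduct-asymmetric : ¬ R 1ℤ -1ℤ → farProduct ≅ 1ℤ
    farProduct-asymmetric ¬r = ≅-trans farProduct≅diagonal (sum-ε p λ i →
      when-no (R? (- lift i) (lift i)) {when (close? (lift i) (lift i)) -1ℤ} λ r → ¬r (R-sym (unit (lift i) r)))
      where
      unit : ∀ a → R (- a) a → R -1ℤ 1ℤ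
      unit a r = R-unscale a (R-nonzero (R-sym r)) (R-resp
        (≅-reflexive (solve 1 (λ a → :- a := a :* con -1ℤ) ≡.refl a)) (≅-reflexive (≡.sym (ℤ.*-identityʳ a))) r)

    -- Orienting the pairs so that the difference lies in the half-system.

    Above : ℤ → ℤ → Set
    Above a b = a %ℕ p ℕ.< b %ℕ p × b %ℕ p ℕ.≤ a %ℕ p ℕ.+ n

    above? : ∀ a b → Dec (Above a b)
    above? a b = (a %ℕ p ℕ.<? b %ℕ p) ×-dec (b %ℕ p ℕ.≤? a %ℕ p ℕ.+ n)

    difference-% : ∀ {a b} → a %ℕ p ℕ.≤ b %ℕ p → (b ℤ.- a) %ℕ p ≡ b %ℕ p ℕ.∸ a %ℕ p
    difference-% {a} {b} a≤b = %-unique (ℕ.≤-<-trans (ℕ.m∸n≤m (b %ℕ p) (a %ℕ p)) (n%ℕd<d b p))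
      (≅-trans (+-cong (≅-sym (%-≅ b)) (neg-cong (≅-sym (%-≅ a))))
        (≅-reflexive (≡.trans (ℤ.m-n≡m⊖n (b %ℕ p) (a %ℕ p)) (ℤ.⊖-≥ a≤b))))

    -- Together with `far⇒half` and `half⇒¬neither` this shows that b - a lies in the half-system
    -- exactly when (a, b) is `Above` or `Far`: either b - a is already between 1 and n, or a - b
    -- exceeds n and b - a wraps around modulo p.
    above⇒half : ∀ {a b} → Above a b → Half (b ℤ.- a)
    above⇒half {a} {b} (a<b , b≤a+n) =
      ≡.subst (λ r → 1 ℕ.≤ r × r ℕ.≤ n) (≡.sym (difference-% {a} {b} (ℕ.<⇒≤ a<b)))
        (ℕ.m<n⇒0<n∸m a<b , ℕ.m≤n+o⇒m∸n≤o (b %ℕ p) (a %ℕ p) b≤a+n)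

    half⇒above : ∀ {a b} → a %ℕ p ℕ.≤ b %ℕ p → Half (b ℤ.- a) → Above a b
    half⇒above {a} {b} a≤b (1≤ , ≤n) =
        ℕ.≰⇒> (λ b≤a → ℕ.n>0⇒n≢0 (≡.subst (1 ℕ.≤_) e 1≤) (ℕ.m≤n⇒m∸n≡0 b≤a))
      , ℕ.≤-trans (ℕ.m≤n+m∸n (b %ℕ p) (a %ℕ p)) (ℕ.+-monoʳ-≤ (a %ℕ p) (≡.subst (ℕ._≤ n) e ≤n))
      where
      e : (b ℤ.- a) %ℕ p ≡ b %ℕ p ℕ.∸ a %ℕ p
      e = difference-% {a} {b} a≤b

    swap-difference : ∀ a b → - (a ℤ.- b) ≅ b ℤ.- a
    swap-difference a b = ≅-reflexive (solve 2 (λ a b → :- (a :- b) := b :- a) ≡.refl a b)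

    far⇒half : ∀ {a b} → Far a b → Half (b ℤ.- a)
    far⇒half {a} {b} far = half-cong (swap-difference a b)
      (¬half⇒half-negate {a ℤ.- b} a-b≇0 λ h → ℕ.<⇒≱ far (proj₂ (half⇒above {b} {a} (ℕ.<⇒≤ b<a) h)))
      where
      b<a : b %ℕ p ℕ.< a %ℕ p
      b<a = ℕ.≤-<-trans (ℕ.m≤m+n (b %ℕ p) n) far

      a-b≇0 : ¬ a ℤ.- b ≅ 0ℤ
      a-b≇0 e = ℕ.<⇒≢ b<a (≡.sym (%-cong (≅-from-difference {a} {b} e)))

    half⇒¬neither : ∀ {a b} → Half (b ℤ.- a) → ¬ Above a b → ¬ Far a b → ⊥
    half⇒¬neither {a} {b} h ¬above ¬far =
      [ (λ a≤b → ¬above (half⇒above {a} {b} a≤b h))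
      , (λ b≤a → half-negate⇒¬half {a ℤ.- b} (half-cong (≅-sym (swap-difference a b)) h)
          (above⇒half {b} {a} (b<a b≤a , ℕ.≮⇒≥ ¬far)))
      ]′ (ℕ.≤-total (a %ℕ p) (b %ℕ p))
      where
      b<a : b %ℕ p ℕ.≤ a %ℕ p → b %ℕ p ℕ.< a %ℕ p
      b<a b≤a = ℕ.≤∧≢⇒< b≤a λ e → half≇0 h (≅-trans
        (+-cong (≅-trans (≅-sym (%-≅ b)) (≅-trans (≅-reflexive (≡.cong +_ e)) (%-≅ a))) (≅-refl { - a }))
        (≅-reflexive (ℤ.+-inverseʳ a)))

    halfDifference : ℤ → ℤ
    halfDifference d = when (half? d) d

    -- In the second factor on the left the roles of a and b are exchanged, so that
    -- each related pair occurs as the ordered pair whose difference is at most n modulo p.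
    orient : ∀ a b → when (above? a b) (b ℤ.- a) ℤ.* when (far? a b) (a ℤ.- b) ≅
                     halfDifference (b ℤ.- a) ℤ.* farSign a b
    orient a b = by-cases (above? a b) (far? a b)
      where
      by-cases : Dec (Above a b) → Dec (Far a b) →
                 when (above? a b) (b ℤ.- a) ℤ.* when (far? a b) (a ℤ.- b) ≅
                 halfDifference (b ℤ.- a) ℤ.* farSign a b
      by-cases (yes (a<b , _)) (yes far) =
        contradiction (ℕ.<-trans a<b (ℕ.≤-<-trans (ℕ.m≤m+n (b %ℕ p) n) far)) (ℕ.<-irrefl ≡.refl)
      by-cases (yes above) (no ¬far) = *-cong
        (≅-trans (when-yes (above? a b) {b ℤ.- a} above)
          (≅-sym (when-yes (half? (b ℤ.- a)) {b ℤ.- a} (above⇒half {a} {b} above))))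
        (≅-trans (when-no (far? a b) {a ℤ.- b} ¬far) (≅-sym (when-no (far? a b) { -1ℤ } ¬far)))
      by-cases (no ¬above) (yes far) = ≅-trans
        (*-cong (when-no (above? a b) {b ℤ.- a} ¬above) (when-yes (far? a b) {a ℤ.- b} far))
        (≅-trans (≅-reflexive (solve 2 (λ a b → con 1ℤ :* (a :- b) := (b :- a) :* con -1ℤ) ≡.refl a b))
          (≅-sym (*-cong (when-yes (half? (b ℤ.- a)) {b ℤ.- a} (far⇒half {a} {b} far))
                         (when-yes (far? a b) { -1ℤ } far))))
      by-cases (no ¬above) (no ¬far) = *-cong
        (≅-trans (when-no (above? a b) {b ℤ.- a} ¬above)
          (≅-sym (when-no (half? (b ℤ.- a)) {b ℤ.- a} λ h → half⇒¬neither {a} {b} h ¬above ¬far)))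
        (≅-trans (when-no (far? a b) {a ℤ.- b} ¬far) (≅-sym (when-no (far? a b) { -1ℤ } ¬far)))

    -- An increasing pair has distance at most n or greater than n. The second case is phrased as
    -- `Far b a`, so that exchanging the variables in that part of the product, which the symmetry
    -- of `R` permits, gives the second factor in `orient`.
    split-order : ∀ a b → when (a %ℕ p ℕ.<? b %ℕ p) (b ℤ.- a) ≅
                          when (above? a b) (b ℤ.- a) ℤ.* when (far? b a) (b ℤ.- a)
    split-order a b = by-cases (above? a b) (far? b a)
      where
      by-cases : Dec (Above a b) → Dec (Far b a) →
                 when (a %ℕ p ℕ.<? b %ℕ p) (b ℤ.- a) ≅
                 when (above? a b) (b ℤ.- a) ℤ.* when (far? b a) (b ℤ.- a)
      by-cases (yes (_ , b≤a+n)) (yes far) = contradiction b≤a+n (ℕ.<⇒≱ far)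
      by-cases (yes above) (no ¬far) = ≅-trans
        (when-yes (a %ℕ p ℕ.<? b %ℕ p) {b ℤ.- a} (proj₁ above))
        (≅-sym (≅-trans (*-cong (when-yes (above? a b) {b ℤ.- a} above) (when-no (far? b a) {b ℤ.- a} ¬far))
          (≅-reflexive (ℤ.*-identityʳ (b ℤ.- a)))))
      by-cases (no ¬above) (yes far) = ≅-trans
        (when-yes (a %ℕ p ℕ.<? b %ℕ p) {b ℤ.- a} (ℕ.≤-<-trans (ℕ.m≤m+n (a %ℕ p) n) far))
        (≅-sym (≅-trans (*-cong (when-no (above? a b) {b ℤ.- a} ¬above) (when-yes (far? b a) {b ℤ.- a} far))
          (≅-reflexive (ℤ.*-identityˡ (b ℤ.- a)))))
      by-cases (no ¬above) (no ¬far) = ≅-trans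
        (when-no (a %ℕ p ℕ.<? b %ℕ p) {b ℤ.- a} λ a<b → ¬above (a<b , ℕ.≮⇒≥ ¬far))
        (≅-sym (*-cong (when-no (above? a b) {b ℤ.- a} ¬above) (when-no (far? b a) {b ℤ.- a} ¬far)))

    ∏∏-when-* : (f g : ℤ → ℤ → ℤ) → ∏ₚ (λ a → ∏ₚ λ b → when (R? a b) (f a b ℤ.* g a b)) ≅
      ∏ₚ (λ a → ∏ₚ λ b → when (R? a b) (f a b)) ℤ.* ∏ₚ (λ a → ∏ₚ λ b → when (R? a b) (g a b))
    ∏∏-when-* f g = ≅-trans
      (residueSum-cong *-commutativeMonoid λ a → ≅-trans
        (residueSum-cong *-commutativeMonoid λ b → when-∙ (R? a b) (f a b) (g a b))
        (sum-distrib p (λ j → when (R? a (lift j)) (f a (lift j))) (λ j → when (R? a (lift j)) (g a (lift j)))))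
      (sum-distrib p (λ i → ∏ₚ λ b → when (R? (lift i) b) (f (lift i) b))
                     (λ i → ∏ₚ λ b → when (R? (lift i) b) (g (lift i) b)))

    pairProduct : ℤ
    pairProduct = ∏ₚ λ a → ∏ₚ λ b → when (R? a b) (when (a %ℕ p ℕ.<? b %ℕ p) (b ℤ.- a))

    ∏-power : ∀ (f : ℤ → ℤ) j → ∏ₚ (λ a → j • f a) ≅ j • ∏ₚ f
    ∏-power f zero    = sum-ε p λ _ → ≅-refl
    ∏-power f (suc j) = ≅-trans (sum-distrib p (f ∘ lift) (λ i → j • f (lift i)))
      (*-cong (≅-refl {∏ₚ f}) (∏-power f j))

    halfDifference-cong : ∀ {a b} → a ≅ b → halfDifference a ≅ halfDifference b
    halfDifference-cong a≅b = half-when-cong a≅b a≅b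

    •-1 : ∀ j → j • 1ℤ ≅ 1ℤ
    •-1 j = ≅-reflexive (≡.trans (•≡^ j 1ℤ) (ℤ.^-zeroˡ j))

    •-cong : ∀ j {a b} → a ≅ b → j • a ≅ j • b
    •-cong zero    a≅b = ≅-refl
    •-cong (suc j) a≅b = *-cong a≅b (•-cong j a≅b)

    halfDifferences : ∏ₚ (λ a → ∏ₚ λ b → when (R? a b) (halfDifference (b ℤ.- a))) ≅ neighbours • halfProduct
    halfDifferences = begin
      ∏ₚ (λ a → ∏ₚ λ b → when (R? a b) (halfDifference (b ℤ.- a)))
        ≈⟨ sum-over-differences *-commutativeMonoid (λ a b → when (R? a b) (halfDifference (b ℤ.- a)))
             (λ {a} {b} {c} → f-cong a {b} {c}) ⟩
      ∏ₚ (λ d → ∏ₚ λ a → when (R? a (d ℤ.+ a)) (halfDifference (d ℤ.+ a ℤ.- a)))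
        ≈⟨ residueSum-cong *-commutativeMonoid (λ d → residueSum-cong *-commutativeMonoid λ a →
             when-congʳ (R? a (d ℤ.+ a)) {halfDifference (d ℤ.+ a ℤ.- a)} {halfDifference d} λ _ → halfDifference-cong
               (≅-reflexive (solve 2 (λ d a → d :+ a :- a := d) ≡.refl d a))) ⟩
      ∏ₚ (λ d → ∏ₚ λ a → when (R? a (d ℤ.+ a)) (halfDifference d))
        ≈⟨ residueSum-cong *-commutativeMonoid (λ d → at-difference d (d ≅? 0ℤ)) ⟩
      ∏ₚ (λ d → neighbours • halfDifference d)
        ≈⟨ ∏-power halfDifference neighbours ⟩
      neighbours • halfProduct ∎
      where
      open ≅-Reasoning

      f-cong : ∀ a {b c} → b ≅ c → when (R? a b) (halfDifference (b ℤ.- a)) ≅ when (R? a c) (halfDifference (c ℤ.- a))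
      f-cong a {b} {c} b≅c = when-cong (R? a b) (R? a c) (R-resp (≅-refl {a}) b≅c) (R-resp (≅-refl {a}) (≅-sym b≅c))
        {halfDifference (b ℤ.- a)} {halfDifference (c ℤ.- a)} (λ _ → halfDifference-cong (+-cong b≅c (≅-refl { - a })))

      at-difference : ∀ d → Dec (d ≅ 0ℤ) →
        ∏ₚ (λ a → when (R? a (d ℤ.+ a)) (halfDifference d)) ≅ neighbours • halfDifference d
      at-difference d (no d≇0)  = sum-at-difference *-commutativeMonoid (halfDifference d) d d≇0
      -- Here the number of related pairs is not `neighbours`, but the factor is 1, because 0 lies
      -- outside the half-system.
      at-difference d (yes d≅0) = ≅-trans
        (sum-ε p λ i → ≅-trans (when-congʳ (R? (lift i) (d ℤ.+ lift i)) {halfDifference d} {1ℤ} (λ _ → trivial))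
          (when-ε (R? (lift i) (d ℤ.+ lift i))))
        (≅-sym (≅-trans (•-cong neighbours trivial) (•-1 neighbours)))
        where
        trivial : halfDifference d ≅ 1ℤ
        trivial = when-no (half? d) {d} λ h → half≇0 h d≅0

    pairProduct≅ : pairProduct ≅ neighbours • halfProduct ℤ.* farProduct
    pairProduct≅ = begin
      pairProduct
        ≈⟨ residueSum-cong *-commutativeMonoid (λ a → residueSum-cong *-commutativeMonoid λ b →
             when-congʳ (R? a b) {when (a %ℕ p ℕ.<? b %ℕ p) (b ℤ.- a)} {u a b ℤ.* v a b} (λ _ → split-order a b)) ⟩
      ∏ₚ (λ a → ∏ₚ λ b → when (R? a b) (u a b ℤ.* v a b))
        ≈⟨ ∏∏-when-* u v ⟩
      ∏ₚ (λ a → ∏ₚ λ b → when (R? a b) (u a b)) ℤ.* ∏ₚ (λ a → ∏ₚ λ b → when (R? a b) (v a b))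
        ≈⟨ *-cong (≅-refl {∏ₚ (λ a → ∏ₚ λ b → when (R? a b) (u a b))}) (≅-trans
             (∑-comm {p} {p} (λ i j → when (R? (lift i) (lift j)) (v (lift i) (lift j))))
             (residueSum-cong *-commutativeMonoid λ a → residueSum-cong *-commutativeMonoid λ b →
               when-cong (R? b a) (R? a b) R-sym R-sym {v b a} {v b a} (λ _ → ≅-refl))) ⟩
      ∏ₚ (λ a → ∏ₚ λ b → when (R? a b) (u a b)) ℤ.* ∏ₚ (λ a → ∏ₚ λ b → when (R? a b) (v b a))
        ≈⟨ ∏∏-when-* u (λ a b → v b a) ⟨
      ∏ₚ (λ a → ∏ₚ λ b → when (R? a b) (u a b ℤ.* v b a))
        ≈⟨ residueSum-cong *-commutativeMonoid (λ a → residueSum-cong *-commutativeMonoid λ b →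
             when-congʳ (R? a b) {u a b ℤ.* v b a} {halfDifference (b ℤ.- a) ℤ.* farSign a b} (λ _ → orient a b)) ⟩
      ∏ₚ (λ a → ∏ₚ λ b → when (R? a b) (halfDifference (b ℤ.- a) ℤ.* farSign a b))
        ≈⟨ ∏∏-when-* (λ a b → halfDifference (b ℤ.- a)) farSign ⟩
      ∏ₚ (λ a → ∏ₚ λ b → when (R? a b) (halfDifference (b ℤ.- a))) ℤ.* farProduct
        ≈⟨ *-cong halfDifferences (≅-refl {farProduct}) ⟩
      neighbours • halfProduct ℤ.* farProduct ∎
      where
      open ≅-Reasoning

      u v : ℤ → ℤ → ℤ
      u a b = when (above? a b) (b ℤ.- a)
      v a b = when (far? b a) (b ℤ.- a)

    -- The value of the product according to the parity of `neighbours`.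

    halfProduct-even-power : ∀ j → (2 ℕ.* j) • halfProduct ≅ -1ℤ ℤ.^ (suc n ℕ.* j)
    halfProduct-even-power j = begin
      (2 ℕ.* j) • F          ≡⟨ •≡^ (2 ℕ.* j) F ⟩
      F ℤ.^ (2 ℕ.* j)        ≡⟨ ℤ.^-*-assoc F 2 j ⟨
      (F ℤ.^ 2) ℤ.^ j        ≡⟨ •≡^ j (F ℤ.^ 2) ⟨
      j • (F ℤ.^ 2)          ≈⟨ •-cong j F²≅ ⟩
      j • (-1ℤ ℤ.^ suc n)    ≡⟨ •≡^ j (-1ℤ ℤ.^ suc n) ⟩
      (-1ℤ ℤ.^ suc n) ℤ.^ j  ≡⟨ ℤ.^-*-assoc -1ℤ (suc n) j ⟩
      -1ℤ ℤ.^ (suc n ℕ.* j)  ∎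
      where
      open ≅-Reasoning
      F = halfProduct

      F²≅ : F ℤ.^ 2 ≅ -1ℤ ℤ.^ suc n
      F²≅ = ≅-trans (≅-reflexive (≡.cong (F ℤ.*_) (ℤ.*-identityʳ F))) halfProduct²

    [-1]^2j≡1 : ∀ j → -1ℤ ℤ.^ (2 ℕ.* j) ≡ 1ℤ
    [-1]^2j≡1 j = ≡.trans (≡.sym (ℤ.^-*-assoc -1ℤ 2 j)) (ℤ.^-zeroˡ j)

    odd-neighbours⇒R : ∀ j → neighbours ≡ suc (2 ℕ.* j) → R 1ℤ -1ℤ
    odd-neighbours⇒R j eq = by-cases (R? 1ℤ -1ℤ)
      where
      by-cases : Dec (R 1ℤ -1ℤ) → R 1ℤ -1ℤ
      by-cases (yes r) = r
      by-cases (no ¬r) = contradiction (≅-trans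
        (≅-reflexive (≡.sym (≡.trans (≡.cong (-1ℤ ℤ.^_) eq) (≡.cong (-1ℤ ℤ.*_) ([-1]^2j≡1 j)))))
        (≅-trans parity (when-no (R? 1ℤ -1ℤ) { -1ℤ } ¬r))) -1≇1

    even-neighbours⇒¬R : ∀ j → neighbours ≡ 2 ℕ.* j → ¬ R 1ℤ -1ℤ
    even-neighbours⇒¬R j eq r = -1≇1 (≅-trans
      (≅-sym (≅-trans parity (when-yes (R? 1ℤ -1ℤ) { -1ℤ } r)))
      (≅-reflexive (≡.trans (≡.cong (-1ℤ ℤ.^_) eq) ([-1]^2j≡1 j))))

    -- An odd power of `halfProduct` leaves one n! besides a sign, and the far pairs add ⌊n/2⌋ to
    -- the exponent because -1 is related to 1. For an even power nothing of n! remains and the far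
    -- pairs cancel altogether.
    pairProduct-odd : ∀ j → neighbours ≡ suc (2 ℕ.* j) →
                      pairProduct ≅ -1ℤ ℤ.^ (suc n ℕ.* j ℕ.+ n ℕ./ 2) ℤ.* + (n !)
    pairProduct-odd j eq = begin
      pairProduct
        ≈⟨ pairProduct≅ ⟩
      neighbours • F ℤ.* farProduct
        ≡⟨ ≡.cong (λ c → c • F ℤ.* farProduct) eq ⟩
      F ℤ.* (2 ℕ.* j) • F ℤ.* farProduct
        ≈⟨ *-cong (*-cong halfProduct≅n! (halfProduct-even-power j))
             (farProduct-symmetric (odd-neighbours⇒R j eq)) ⟩
      + (n !) ℤ.* s ℤ.* t
        ≡⟨ solve 3 (λ f s t → f :* s :* t := s :* t :* f) ≡.refl (+ (n !)) s t ⟩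
      s ℤ.* t ℤ.* + (n !)
        ≡⟨ ≡.cong (ℤ._* + (n !)) (ℤ.^-distribˡ-+-* -1ℤ (suc n ℕ.* j) (n ℕ./ 2)) ⟨
      -1ℤ ℤ.^ (suc n ℕ.* j ℕ.+ n ℕ./ 2) ℤ.* + (n !) ∎
      where
      open ≅-Reasoning
      F = halfProduct
      s = -1ℤ ℤ.^ (suc n ℕ.* j)
      t = -1ℤ ℤ.^ (n ℕ./ 2)

    pairProduct-even : ∀ j → neighbours ≡ 2 ℕ.* j → pairProduct ≅ -1ℤ ℤ.^ (suc n ℕ.* j)
    pairProduct-even j eq = begin
      pairProduct
        ≈⟨ pairProduct≅ ⟩
      neighbours • halfProduct ℤ.* farProduct
        ≡⟨ ≡.cong (λ c → c • halfProduct ℤ.* farProduct) eq ⟩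
      (2 ℕ.* j) • halfProduct ℤ.* farProduct
        ≈⟨ *-cong (halfProduct-even-power j) (farProduct-asymmetric (even-neighbours⇒¬R j eq)) ⟩
      -1ℤ ℤ.^ (suc n ℕ.* j) ℤ.* 1ℤ
        ≡⟨ ℤ.*-identityʳ (-1ℤ ℤ.^ (suc n ℕ.* j)) ⟩
      -1ℤ ℤ.^ (suc n ℕ.* j) ∎
      where open ≅-Reasoning

-- The listed cosets partition the group, and translation permutes them.

module Cosets {c ℓ r s} (G : Group c ℓ) (H : Subgroup G r) {m}
  {A : Fin m → Pred (Group.Carrier G) s} (cosets : AreTheDistinctCosets G H A) where

  open Group G
  open Subgroup H
  open AreTheDistinctCosets cosets
  open import Algebra.Properties.Group G using (x≈z//y)

  covered : ∀ x → ∃ λ i → A i x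
  covered x with complete x
  ... | i , coset⊆A , _ = i , coset⊆A (ε , ε-closed , sym (identityʳ x))

  translate : ∀ g {i x y} → A i x → A i y → ∃ λ j → A j (g ∙ x) × A j (g ∙ y)
  translate g {i} Ax Ay with isCoset i
  ... | g′ , A⊆coset , _ with A⊆coset Ax | A⊆coset Ay | complete (g ∙ g′)
  ... | h , h∈H , x≈g′h | h′ , h′∈H , y≈g′h′ | j , coset⊆A , _ =
    j , coset⊆A (h , h∈H , trans (∙-congˡ x≈g′h) (sym (assoc g g′ h)))
      , coset⊆A (h′ , h′∈H , trans (∙-congˡ y≈g′h′) (sym (assoc g g′ h′)))

  private
    -- A common point x = g h = g′ h′ gives g = x h⁻¹, so any g h″ equals g′ (h′ h⁻¹ h″).
    meet⇒⊆ : ∀ {i j x} → A i x → A j x → ∀ {y} → A i y → A j y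
    meet⇒⊆ {i} {j} {x} Aix Ajx {y} Aiy with isCoset i | isCoset j
    ... | g , A⊆gH , _ | g′ , A⊆g′H , g′H⊆A with A⊆gH Aix | A⊆g′H Ajx | A⊆gH Aiy
    ... | h , h∈H , x≈gh | h′ , h′∈H , x≈g′h′ | h″ , h″∈H , y≈gh″ =
      g′H⊆A (h′ ∙ (h ⁻¹ ∙ h″) , ∙-closed h′∈H (∙-closed (⁻¹-closed h∈H) h″∈H) , (begin
        y                       ≈⟨ y≈gh″ ⟩
        g ∙ h″                  ≈⟨ ∙-congʳ (x≈z//y g h x (sym x≈gh)) ⟩
        (x ∙ h ⁻¹) ∙ h″         ≈⟨ assoc x (h ⁻¹) h″ ⟩
        x ∙ (h ⁻¹ ∙ h″)         ≈⟨ ∙-congʳ x≈g′h′ ⟩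
        (g′ ∙ h′) ∙ (h ⁻¹ ∙ h″) ≈⟨ assoc g′ h′ (h ⁻¹ ∙ h″) ⟩
        g′ ∙ (h′ ∙ (h ⁻¹ ∙ h″)) ∎))
      where open import Relation.Binary.Reasoning.Setoid setoid

  disjoint : ∀ {i j x} → A i x → A j x → i ≡ j
  disjoint Aix Ajx = distinct (meet⇒⊆ Aix Ajx , meet⇒⊆ Ajx Aix)

-- The relation given by the listed cosets, and the product of the theorem as a product over related
-- pairs.

module CosetPairs
  (p : ℕ) (p-prime : Prime p) (n : ℕ) (p≡ : p ≡ suc (n ℕ.+ n)) (k m : ℕ)
  (α : Fin m → Fin k → ℕ) (bounds : ∀ i t → 1 ℕ.≤ α i t × α i t ℕ.≤ p ℕ.∸ 1)
  (increasing : ∀ i {s t} → s Fin.< t → α i s ℕ.< α i t)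
  (cosets : AreTheDistinctCosets (AbelianGroup.group (unitGroup p p-prime)) (powerSubgroup p p-prime m)
              (λ i → residueSet (α i)))
  where

  open OddPrime p p-prime n p≡
  open Cosets (AbelianGroup.group (unitGroup p p-prime)) (powerSubgroup p p-prime m) cosets

  point : ∀ i t → Residue p
  point i t = residue (α i t) (proj₁ (bounds i t)) (proj₂ (bounds i t))

  point∈ : ∀ i t → residueSet (α i) (point i t)
  point∈ i t = t , mod-refl p (+ α i t)

  α<p : ∀ i t → α i t ℕ.< p
  α<p i t = ℕ.≤-<-trans (proj₂ (bounds i t)) (ℕ.≤-reflexive (ℕ.suc-pred p))

  α≇0 : ∀ i t → ¬ + α i t ≅ 0ℤ
  α≇0 i t e = ℕ.n>0⇒n≢0 (proj₁ (bounds i t)) (small-≅⇒≡ (α<p i t) (ℕ.≤-<-trans ℕ.z≤n n<p) e)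

  α-% : ∀ i t → (+ α i t) %ℕ p ≡ α i t
  α-% i t = %-unique (α<p i t) ≅-refl

  index-unique : ∀ {i j t s} → + α i t ≅ + α j s → i ≡ j
  index-unique {i} {j} {t} {s} e = disjoint {x = point i t} (point∈ i t) (s , difference e)

  α-injective : ∀ i {t s} → α i t ≡ α i s → t ≡ s
  α-injective i {t} {s} e = by-cases (Fin.<-cmp t s)
    where
    by-cases : _ → t ≡ s
    by-cases (tri< t<s _ _) = contradiction e (ℕ.<⇒≢ (increasing i t<s))
    by-cases (tri≈ _ t≡s _) = t≡s
    by-cases (tri> _ _ s<t) = contradiction (≡.sym e) (ℕ.<⇒≢ (increasing i s<t))

  position-unique : ∀ {i t s} → + α i t ≅ + α i s → t ≡ s
  position-unique {i} {t} {s} e = α-injective i (small-≅⇒≡ (α<p i t) (α<p i s) e)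

  position : ∀ a → ¬ a ≅ 0ℤ → ∃ λ i → ∃ λ t → a ≅ + α i t
  position a a≇0 = i , t , ≅-trans (≅-sym (%-≅ a)) [ e ]
    where
    x : Residue p
    x = class p p-prime a (a≇0 ∘ ∣⇒≅0)
    i = proj₁ (covered x)
    t = proj₁ (proj₂ (covered x))
    e = proj₂ (proj₂ (covered x))

  Listed : ℤ → Fin m → Set
  Listed a i = ∃ λ t → a ≅ + α i t

  -- Being listed in a common row, rather than having a quotient in H, makes the relation decidable
  -- by finite search. Its invariance under scaling is `translate` for the unit group, and 0 is
  -- excluded because every listed number lies between 1 and p - 1.
  R : ℤ → ℤ → Set
  R a b = ∃ λ i → Listed a i × Listed b i

  R? : ∀ a b → Dec (R a b)
  R? a b = Fin.any? λ i → Fin.any? (λ t → a ≅? + α i t) ×-dec Fin.any? (λ t → b ≅? + α i t)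

  R-resp : ∀ {a a′ b b′} → a ≅ a′ → b ≅ b′ → R a b → R a′ b′
  R-resp e f (i , (t , a≅) , (s , b≅)) = i , (t , ≅-trans (≅-sym e) a≅) , (s , ≅-trans (≅-sym f) b≅)

  R-sym : ∀ {a b} → R a b → R b a
  R-sym (i , x , y) = i , y , x

  R-refl : ∀ {a} → ¬ a ≅ 0ℤ → R a a
  R-refl {a} a≇0 = proj₁ (position a a≇0) , proj₂ (position a a≇0) , proj₂ (position a a≇0)

  R-nonzero : ∀ {a b} → R a b → ¬ a ≅ 0ℤ
  R-nonzero (i , (t , a≅) , _) a≅0 = α≇0 i t (≅-trans (≅-sym a≅) a≅0)

  R-scale : ∀ {a b} c → ¬ c ≅ 0ℤ → R a b → R (c ℤ.* a) (c ℤ.* b)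
  R-scale {a} {b} c c≇0 (i , (t , a≅) , (s , b≅)) =
    proj₁ product , scaled a≅ (proj₁ (proj₂ product)) , scaled b≅ (proj₂ (proj₂ product))
    where
    x : Residue p
    x = class p p-prime c (c≇0 ∘ ∣⇒≅0)

    product : ∃ λ j → _ × _
    product = translate x {i} {point i t} {point i s} (point∈ i t) (point∈ i s)

    scaled : ∀ {a j t} → a ≅ + α i t →
             residueSet (α j) (AbelianGroup._∙_ (unitGroup p p-prime) x (point i t)) → Listed (c ℤ.* a) j
    scaled {a} {j} {t} a≅ (u , e) = u , ≅-trans
      (*-cong (≅-sym (%-≅ c)) a≅) (≅-trans (≅-sym product-value) [ e ])
      where
      product-value : + rep (AbelianGroup._∙_ (unitGroup p p-prime) x (point i t)) ≅ + rep x ℤ.* + α i t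
      product-value = [ ·-val p p-prime x (point i t) ]

  open Related R R? R-resp R-sym R-scale R-refl R-nonzero public

  R-α⇒≡ : ∀ {i j t s} → R (+ α i t) (+ α j s) → i ≡ j
  R-α⇒≡ {i} {j} {t} {s} (l , (t′ , e) , (s′ , f)) =
    ≡.trans (index-unique {i} {l} {t} {t′} e) (≡.sym (index-unique {j} {l} {s} {s′} f))

  R-α : ∀ i t s → R (+ α i t) (+ α i s)
  R-α i t s = i , (t , ≅-refl) , (s , ≅-refl)

  module _ {c ℓ} (M : CommutativeMonoid c ℓ) where
    open CommutativeMonoid M using (Carrier; _≈_; ε; refl; sym; trans; setoid)
    private module B = BigOperator M

    -- The incidence `a ≅ + α i t` is summed in both orders. A nonzero residue is listed in exactly
    -- one place; 0 is listed nowhere, whence the condition on `f 0ℤ`.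
    sum-over-cosets : (f : ℤ → Carrier) → (∀ {a b} → a ≅ b → f a ≈ f b) → f 0ℤ ≈ ε →
                      residueSum M f ≈ B.sum (λ i → B.sum λ t → f (+ α i t))
    sum-over-cosets f f-cong f0≈ε = begin
      residueSum M f
        ≈⟨ B.sum-cong p (λ x → column (lift x) (lift x ≅? 0ℤ)) ⟨
      residueSum M (λ a → B.sum λ i → B.sum λ t → at i t a)
        ≈⟨ B.∑-comm {p} {m} (λ x i → B.sum λ t → at i t (lift x)) ⟩
      B.sum (λ i → residueSum M λ a → B.sum λ t → at i t a)
        ≈⟨ B.sum-cong m (λ i → B.∑-comm {p} {k} (λ x t → at i t (lift x))) ⟩
      B.sum (λ i → B.sum λ t → residueSum M (at i t))
        ≈⟨ B.sum-cong m (λ i → B.sum-cong k λ t → entry i t) ⟩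
      B.sum (λ i → B.sum λ t → f (+ α i t)) ∎
      where
      open import Relation.Binary.Reasoning.Setoid setoid

      at : Fin m → Fin k → ℤ → Carrier
      at i t a = B.when (a ≅? + α i t) (f a)

      at-cong : ∀ i t {a b} → a ≅ b → at i t a ≈ at i t b
      at-cong i t {a} {b} a≅b = B.when-cong (a ≅? + α i t) (b ≅? + α i t)
        (≅-trans (≅-sym a≅b)) (≅-trans a≅b) {f a} {f b} (λ _ → f-cong a≅b)

      entry : ∀ i t → residueSum M (at i t) ≈ f (+ α i t)
      entry i t = trans
        (residueSum-single M (at i t) (at-cong i t) (+ α i t) λ a → B.when-no (a ≅? + α i t) {f a})
        (B.when-yes (+ α i t ≅? + α i t) {f (+ α i t)} ≅-refl)

      column : ∀ a → Dec (a ≅ 0ℤ) → B.sum (λ i → B.sum λ t → at i t a) ≈ f a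
      column a (yes a≅0) = trans
        (B.sum-ε m λ i → B.sum-ε k λ t → B.when-no (a ≅? + α i t) {f a} λ e →
          α≇0 i t (≅-trans (≅-sym e) a≅0))
        (sym (trans (f-cong a≅0) f0≈ε))
      column a (no a≇0) = trans
        (B.sum-single {m} {λ i → B.sum λ t → at i t a} i₀ λ i i≢i₀ → B.sum-ε k λ t →
          B.when-no (a ≅? + α i t) {f a} λ e →
            i≢i₀ (index-unique {i} {i₀} {t} {t₀} (≅-trans (≅-sym e) a≅)))
        (trans
          (B.sum-single {k} {λ t → at i₀ t a} t₀ λ t t≢t₀ → B.when-no (a ≅? + α i₀ t) {f a} λ e →
            t≢t₀ (position-unique {i₀} {t} {t₀} (≅-trans (≅-sym e) a≅)))
          (B.when-yes (a ≅? + α i₀ t₀) {f a} a≅))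
        where
        i₀ = proj₁ (position a a≇0)
        t₀ = proj₁ (proj₂ (position a a≇0))
        a≅ : a ≅ + α i₀ t₀
        a≅ = proj₂ (proj₂ (position a a≇0))

    sum-over-related : ∀ i t (f : ℤ → Carrier) → (∀ {a b} → a ≅ b → f a ≈ f b) →
      residueSum M (λ a → B.when (R? a (+ α i t)) (f a)) ≈ B.sum (λ s → f (+ α i s))
    sum-over-related i t f f-cong = trans
      (sum-over-cosets (λ a → B.when (R? a (+ α i t)) (f a))
        (λ {a} {b} a≅b → B.when-cong (R? a (+ α i t)) (R? b (+ α i t))
          (R-resp a≅b ≅-refl) (R-resp (≅-sym a≅b) ≅-refl) {f a} {f b} (λ _ → f-cong a≅b))
        (B.when-no (R? 0ℤ (+ α i t)) {f 0ℤ} λ r → R-nonzero r ≅-refl))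
      (trans
        (B.sum-single {m} {λ j → B.sum λ s → B.when (R? (+ α j s) (+ α i t)) (f (+ α j s))} i λ j j≢i →
          B.sum-ε k λ s → B.when-no (R? (+ α j s) (+ α i t)) {f (+ α j s)} (j≢i ∘ R-α⇒≡ {j} {i} {s} {t}))
        (B.sum-cong k λ s → B.when-yes (R? (+ α i s) (+ α i t)) {f (+ α i s)} (R-α i s t)))

  -- A nonzero residue is related precisely to the k members of its own row, which is the degree
  -- that `degree≡1+neighbours` asks for.
  k≡1+neighbours : k ≡ suc neighbours
  k≡1+neighbours = degree≡1+neighbours k λ a a≇0 →
    degree a (position a a≇0)
    where
    degree : ∀ a → (∃ λ i → ∃ λ t → a ≅ + α i t) → ℕ-sum (λ b → Count.when (R? a b) 1) ≡ k
    degree a (i , t , a≅) = ≡.trans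
      (Count.sum-cong p λ x → Count.when-cong (R? a (lift x)) (R? (lift x) (+ α i t))
        (R-sym ∘ R-resp a≅ ≅-refl) (R-resp (≅-sym a≅) ≅-refl ∘ R-sym) {1} {1} (λ _ → ≡.refl))
      (≡.trans (sum-over-related ℕ.+-0-commutativeMonoid i t (λ _ → 1) (λ _ → ≡.refl))
        (≡.trans (Count.sum-replicate k {1}) (≡.trans (•≡* k 1) (ℕ.*-identityʳ k))))

  pairProduct≅∏differenceProduct : pairProduct ≅ ∏ (λ i → differenceProduct (α i))
  pairProduct≅∏differenceProduct = begin
    pairProduct
      -- The outer variable of `pairProduct` is the smaller entry, that of `differenceProduct` the
      -- larger one.
      ≈⟨ ∑-comm {p} {p} (λ x y → term (lift y) (lift x)) ⟩
    ∏ₚ (λ b → ∏ₚ λ a → term b a)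
      ≈⟨ sum-over-cosets *-commutativeMonoid (λ b → ∏ₚ (term b))
           (λ {b} {b′} b≅b′ → residueSum-cong *-commutativeMonoid (term-congˡ b≅b′))
           (residueSum-ε λ a → when-no (R? a 0ℤ) {lower 0ℤ a} λ r → R-nonzero (R-sym r) ≅-refl) ⟩
    ∏ (λ i → ∏ λ t → ∏ₚ (term (+ α i t)))
      ≈⟨ sum-cong m (λ i → sum-cong k λ t →
           sum-over-related *-commutativeMonoid i t (lower (+ α i t)) (λ {a} {b} → lower-cong {+ α i t} {+ α i t} {a} {b} ≅-refl)) ⟩
    ∏ (λ i → ∏ λ t → ∏ λ s → lower (+ α i t) (+ α i s))
      ≈⟨ sum-cong m (λ i → sum-cong k λ t → sum-cong k λ s → when-cong
           ((+ α i s) %ℕ p ℕ.<? (+ α i t) %ℕ p) (s Fin.<? t)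
           (λ lt → reflect i (≡.subst₂ ℕ._<_ (α-% i s) (α-% i t) lt))
           (λ s<t → ≡.subst₂ ℕ._<_ (≡.sym (α-% i s)) (≡.sym (α-% i t)) (increasing i s<t))
           {+ α i t ℤ.- + α i s} {+ α i t ℤ.- + α i s} (λ _ → ≅-refl)) ⟩
    ∏ (λ i → ∏ λ t → ∏ λ s → when (s Fin.<? t) (+ α i t ℤ.- + α i s))
      ≈⟨ sum-cong m (λ i → sum-cong k λ t → sum-inject t (λ s → + α i t ℤ.- + α i s)) ⟨
    ∏ (λ i → differenceProduct (α i)) ∎
    where
    open ≅-Reasoning

    lower : ℤ → ℤ → ℤ
    lower b a = when (a %ℕ p ℕ.<? b %ℕ p) (b ℤ.- a)

    term : ℤ → ℤ → ℤ
    term b a = when (R? a b) (lower b a)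

    lower-cong : ∀ {b b′ a a′} → b ≅ b′ → a ≅ a′ → lower b a ≅ lower b′ a′
    lower-cong {b} {b′} {a} {a′} b≅b′ a≅a′ = when-cong (a %ℕ p ℕ.<? b %ℕ p) (a′ %ℕ p ℕ.<? b′ %ℕ p)
      (≡.subst₂ ℕ._<_ (%-cong a≅a′) (%-cong b≅b′))
      (≡.subst₂ ℕ._<_ (≡.sym (%-cong a≅a′)) (≡.sym (%-cong b≅b′)))
      {b ℤ.- a} {b′ ℤ.- a′} (λ _ → +-cong b≅b′ (neg-cong a≅a′))

    term-congˡ : ∀ {b b′} → b ≅ b′ → ∀ a → term b a ≅ term b′ a
    term-congˡ {b} {b′} b≅b′ a = when-cong (R? a b) (R? a b′)
      (R-resp (≅-refl {a}) b≅b′) (R-resp (≅-refl {a}) (≅-sym b≅b′))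
      {lower b a} {lower b′ a} (λ _ → lower-cong b≅b′ (≅-refl {a}))

    residueSum-ε : ∀ {f} → (∀ a → f a ≅ 1ℤ) → ∏ₚ f ≅ 1ℤ
    residueSum-ε f≅1 = sum-ε p (f≅1 ∘ lift)

    reflect : ∀ i {s t} → α i s ℕ.< α i t → s Fin.< t
    reflect i {s} {t} lt = by-cases (Fin.<-cmp s t)
      where
      by-cases : _ → s Fin.< t
      by-cases (tri< s<t _ _) = s<t
      by-cases (tri≈ _ s≡t _) = contradiction (≡.cong (α i) s≡t) (ℕ.<⇒≢ lt)
      by-cases (tri> _ _ t<s) = contradiction (increasing i t<s) (ℕ.<⇒≯ lt)

-- Parities, and the exponents as they appear in the theorem.

mod⇒∣∸ : ∀ {a b d} → b ≤ a → (+ a) ≡ (+ b) [mod d ] → d ∣ a ∸ b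
mod⇒∣∸ {a} {b} {d} b≤a e = ≡.subst (d ∣_)
  (≡.cong ∣_∣ (≡.trans (ℤ.m-n≡m⊖n a b) (ℤ.⊖-≥ b≤a))) (∣⇒∣ᵤ e)

odd⇒1+n+n : ∀ p → ¬ 2 ∣ p → ∃ λ n → p ≡ suc (n + n)
odd⇒1+n+n p 2∤p = p / 2 , ≡.trans (ℕ.m≡m%n+[m/n]*n p 2)
  (≡.cong₂ _+_ (remainder (p ℕ.% 2) (ℕ.m%n<n p 2) λ e → 2∤p (m%n≡0⇒n∣m p 2 e))
    (≡.trans (ℕ.*-comm (p / 2) 2) (≡.cong (_+_ (p / 2)) (ℕ.+-identityʳ (p / 2)))))
  where
  remainder : ∀ r → r < 2 → ¬ r ≡ 0 → r ≡ 1
  remainder zero          _                r≢0 = contradiction ≡.refl r≢0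
  remainder (suc zero)    _                _   = ≡.refl
  remainder (suc (suc r)) (s≤s (s≤s ()))

n+n≡n*2 : ∀ n → n + n ≡ n * 2
n+n≡n*2 n = ≡.trans (≡.cong (_+_ n) (≡.sym (ℕ.+-identityʳ n))) (ℕ.*-comm 2 n)

[1+n]/2+n/2≡n : ∀ n → suc n / 2 + n / 2 ≡ n
[1+n]/2+n/2≡n zero    = ≡.refl
[1+n]/2+n/2≡n (suc n) = ≡.trans
  (≡.cong (_+ suc n / 2) (ℕ.m/n≡1+[m∸n]/n {suc (suc n)} {2} (s≤s (s≤s z≤n))))
  (≡.cong suc (≡.trans (ℕ.+-comm (n / 2) (suc n / 2)) ([1+n]/2+n/2≡n n)))

[-1]^-parity : ∀ {i j l} → i + j ≡ l * 2 → -1ℤ ℤ.^ i ≡ -1ℤ ℤ.^ j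
[-1]^-parity {i} {j} {l} e = begin
  -1ℤ ℤ.^ i                            ≡⟨ ℤ.*-identityʳ (-1ℤ ℤ.^ i) ⟨
  -1ℤ ℤ.^ i ℤ.* + 1                    ≡⟨ ≡.cong (ℤ._*_ (-1ℤ ℤ.^ i)) (even j) ⟨
  -1ℤ ℤ.^ i ℤ.* -1ℤ ℤ.^ (j * 2)        ≡⟨ ℤ.^-distribˡ-+-* -1ℤ i (j * 2) ⟨
  -1ℤ ℤ.^ (i + j * 2)                  ≡⟨ ≡.cong (λ e → -1ℤ ℤ.^ (i + e)) (n+n≡n*2 j) ⟨
  -1ℤ ℤ.^ (i + (j + j))                ≡⟨ ≡.cong (-1ℤ ℤ.^_) (ℕ.+-assoc i j j) ⟨
  -1ℤ ℤ.^ (i + j + j)                  ≡⟨ ℤ.^-distribˡ-+-* -1ℤ (i + j) j ⟩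
  -1ℤ ℤ.^ (i + j) ℤ.* -1ℤ ℤ.^ j        ≡⟨ ≡.cong (λ e → -1ℤ ℤ.^ e ℤ.* -1ℤ ℤ.^ j) e ⟩
  -1ℤ ℤ.^ (l * 2) ℤ.* -1ℤ ℤ.^ j        ≡⟨ ≡.cong (ℤ._* -1ℤ ℤ.^ j) (even l) ⟩
  + 1 ℤ.* -1ℤ ℤ.^ j                    ≡⟨ ℤ.*-identityˡ (-1ℤ ℤ.^ j) ⟩
  -1ℤ ℤ.^ j                            ∎
  where
  open ≡.≡-Reasoning

  even : ∀ j → -1ℤ ℤ.^ (j * 2) ≡ + 1
  even j = ≡.trans (≡.cong (-1ℤ ℤ.^_) (ℕ.*-comm j 2))
    (≡.trans (≡.sym (ℤ.^-*-assoc -1ℤ 2 j)) (ℤ.^-zeroˡ j))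

-- On the left is the exponent from `pairProduct-odd`, on the right the one in the theorem, where k
-- = 2(j + 1), (p - 1)/(2m) = j + 1 and ⌊(p - 3)/4⌋ = ⌊(n - 1)/2⌋. They differ as numbers but have
-- the same parity: as ⌊n/2⌋ + ⌊(n - 1)/2⌋ = n - 1, their sum is 2((n + 1)j + n).
sign-exponents : ∀ n j → 1 ≤ n →
  -1ℤ ℤ.^ (suc n * j + n / 2) ≡ -1ℤ ℤ.^ (suc n * suc j + (n ∸ 1) / 2)
sign-exponents (suc n) j _ = [-1]^-parity {l = suc (suc n) * j + suc n} (≡.trans
  (solve 4 (λ n j h h′ → ((con 2 :+ n) :* j :+ h) :+ ((con 2 :+ n) :* (con 1 :+ j) :+ h′)
                      := (con 2 :+ n) :* j :* con 2 :+ (con 2 :+ n :+ (h :+ h′))) ≡.refl n j (suc n / 2) (n / 2))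
  (≡.trans (≡.cong (λ h → suc (suc n) * j * 2 + (2 + n + h)) ([1+n]/2+n/2≡n n))
    (solve 2 (λ n j → (con 2 :+ n) :* j :* con 2 :+ (con 2 :+ n :+ n)
                   := ((con 2 :+ n) :* j :+ (con 1 :+ n)) :* con 2) ≡.refl n j)))
  where open ℕ-Solver

theorem3p1 : (p : ℕ) (p-prime : Prime p) → ¬ (2 ∣ p) →
    (k m : ℕ) .{{_ : NonZero k}} .{{_ : NonZero m}} → k * m ≡ p ∸ 1 →
    (a : Fin m → Fin k → ℕ) →
    (∀ i j → 1 ≤ a i j × a i j ≤ p ∸ 1) →
    (∀ i {s t} → s Fin.< t → a i s < a i t) →
    AreTheDistinctCosets (AbelianGroup.group (unitGroup p p-prime)) (powerSubgroup p p-prime m)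
    (λ i → residueSet (a i)) →
    ((+ p) ≡ (+ 1) [mod 2 * m ] →
    ∏ (λ i → differenceProduct (a i))
    ≡ -1ℤ ℤ.^ ((p + 1) / 2 * ((p ∸ 1) / (2 * m)) {{m*n≢0 2 m}} + (p ∸ 3) / 4) ℤ.* (+ (((p ∸ 1) / 2) !))
    [mod p ])
    ×
    ((+ p) ≡ (+ (1 + m)) [mod 2 * m ] →
    ∏ (λ i → differenceProduct (a i))
    ≡ -1ℤ ℤ.^ ((p + 1) / 2 * ((p ∸ 1 ∸ m) / (2 * m)) {{m*n≢0 2 m}})
    [mod p ])
theorem3p1 p p-prime 2∤p k m km≡p-1 a bounds increasing cosets with odd⇒1+n+n p 2∤p
... | n , p≡ = even-order , odd-order
  where
  open CosetPairs p p-prime n p≡ k m a bounds increasing cosets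
  open OddPrime p p-prime n p≡ using (1≤n; ≅-sym; ≅-trans; ≅-reflexive)

  instance
    2m≢0 : NonZero (2 * m)
    2m≢0 = m*n≢0 2 m

  1≤p : 1 ≤ p
  1≤p = ℕ.>-nonZero⁻¹ p {{prime⇒nonZero p-prime}}

  p-1≡n+n : p ∸ 1 ≡ n + n
  p-1≡n+n = ≡.cong (_∸ 1) p≡

  n≡[p-1]/2 : n ≡ (p ∸ 1) / 2
  n≡[p-1]/2 = ≡.sym (≡.trans (≡.cong (_/ 2) (≡.trans p-1≡n+n (n+n≡n*2 n))) (ℕ.m*n/n≡m n 2))

  1+n≡[p+1]/2 : suc n ≡ (p + 1) / 2
  1+n≡[p+1]/2 = ≡.sym (≡.trans
    (≡.cong (_/ 2) (≡.trans (≡.cong (_+ 1) p≡)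
      (solve 1 (λ n → con 1 :+ (n :+ n) :+ con 1 := (con 1 :+ n) :* con 2) ≡.refl n)))
    (ℕ.m*n/n≡m (suc n) 2))
    where open ℕ-Solver

  [n-1]/2≡[p-3]/4 : (n ∸ 1) / 2 ≡ (p ∸ 3) / 4
  [n-1]/2≡[p-3]/4 = ≡.sym (≡.trans
    (≡.cong (_/ 4) (≡.trans (≡.cong (_∸ 3) p≡)
      (≡.trans (≡.cong (_∸ 2) (n+n≡n*2 n)) (≡.sym (ℕ.*-distribʳ-∸ 2 n 1)))))
    (ℕ.m*n/o*n≡m/o (n ∸ 1) 2 2))

  quotient : ∀ {e} j → e ≡ 2 * j * m → e / (2 * m) ≡ j
  quotient j e≡ = ≡.trans (≡.cong (_/ (2 * m)) e≡) (≡.trans (ℕ.m*n/o*n≡m/o (2 * j) m 2)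
    (≡.trans (≡.cong (_/ 2) (ℕ.*-comm 2 j)) (ℕ.m*n/n≡m j 2)))

  neighbours*m≡ : p ∸ 1 ∸ m ≡ neighbours * m
  neighbours*m≡ = ≡.trans (≡.cong (_∸ m) (≡.trans (≡.sym km≡p-1) (≡.cong (_* m) k≡1+neighbours)))
    (ℕ.m+n∸m≡n m (neighbours * m))

  m≤p-1 : m ≤ p ∸ 1
  m≤p-1 = ≡.subst (m ≤_) (≡.trans (≡.sym (≡.cong (_* m) k≡1+neighbours)) km≡p-1)
    (ℕ.m≤m+n m (neighbours * m))

  even-order : _
  -- The congruence says that 2m divides p - 1 = km, so k is even; k = 2(j + 1) makes `neighbours`
  -- equal to 2j + 1.
  even-order e with *-cancelʳ-∣ m (≡.subst (2 * m ∣_) (≡.sym km≡p-1) (mod⇒∣∸ 1≤p e))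
  ... | divides zero k≡0 = contradiction (≡.trans (≡.sym k≡1+neighbours) k≡0) λ ()
  ... | divides (suc j) k≡ = difference (≅-trans (≅-sym pairProduct≅∏differenceProduct)
    (≅-trans (pairProduct-odd j neighbours≡) (≅-reflexive (≡.cong₂ ℤ._*_
      (≡.trans (sign-exponents n j 1≤n) (≡.cong (-1ℤ ℤ.^_)
        (≡.cong₂ _+_ (≡.cong₂ _*_ 1+n≡[p+1]/2 (≡.sym (quotient (suc j)
          (≡.trans (≡.sym km≡p-1) (≡.cong (_* m) (≡.trans k≡ (ℕ.*-comm (suc j) 2)))))))
          [n-1]/2≡[p-3]/4)))
      (≡.cong (λ n → + (n !)) n≡[p-1]/2)))))
    where
    neighbours≡ : neighbours ≡ suc (2 * j)
    neighbours≡ = ℕ.suc-injective (≡.trans (≡.sym k≡1+neighbours) (≡.trans k≡ (≡.cong (λ e → suc (suc e)) (ℕ.*-comm j 2))))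

  odd-order : _
  -- Now 2m divides p - 1 - m = (k - 1)m, so `neighbours` = k - 1 is even.
  odd-order e with *-cancelʳ-∣ m (≡.subst (2 * m ∣_)
    (≡.trans (≡.sym (ℕ.∸-+-assoc p 1 m)) neighbours*m≡)
    (mod⇒∣∸ (≡.subst (suc m ≤_) (ℕ.m+[n∸m]≡n 1≤p) (s≤s m≤p-1)) e))
  ... | divides j c≡ = difference (≅-trans (≅-sym pairProduct≅∏differenceProduct)
    (≅-trans (pairProduct-even j c≡2j) (≅-reflexive (≡.cong (-1ℤ ℤ.^_)
      (≡.cong₂ _*_ 1+n≡[p+1]/2 (≡.sym (quotient j (≡.trans neighbours*m≡ (≡.cong (_* m) c≡2j)))))))))
    where
    c≡2j : neighbours ≡ 2 * j
    c≡2j = ≡.trans c≡ (ℕ.*-comm j 2)
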